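{- Suppose $v,w\in\widetilde S_n$ are such that $v\equiv_{\widetilde{\mathrm{syl}}}w$. Then the subtree of the affine stack-sorting tree $\widetilde{\mathscr S}_n$ with root $v$ is isomorphic as a rooted tree to the subtree of $\widetilde{\mathscr S}_n$ with root $w$. In particular, $v$ and $w$ have the same fertility, i.e. $\lvert\widetilde{\mathtt s}^{ -1}(v)\rvert=\lvert\widetilde{\mathtt s}^{ -1}(w)\rvert$.
   Context: An affine permutation of size $n$ is a bijection $w:\mathbb Z\to\mathbb Z$ with $w(i+n)=w(i)+n$ for all $i\in\mathbb Z$ and $\sum_{i=1}^n w(i)=\binom{n+1}{2}$. They form the affine symmetric group $\widetilde S_n$ under composition (trivial if $n=1$), a Coxeter group with simple generators $\widetilde s_1,\ldots,\widetilde s_n$, where $\widetilde s_i$ swaps $i+mn$ and $i+mn+1$ for all $m\in\mathbb Z$ and fixes all other integers. The left weak order is $x\leq_L y\iff\ell(yx^{ -1})=\ell(y)-\ell(x)$, $\ell$ being Coxeter length; $e$ is the identity. Affine sylvester congruence. For $w\in\widetilde S_n$ define a partial order $\preceq_w$ on $\mathbb Z$ (positions): for $i<j$, the positions $i,j$ are incomparable if and only if there is $k$ with $i<k<j$ and $w(k)>\max\{w(i),w(j)\}$; otherwise the position with the smaller value of $w$ is below the other. (This is the descendant order of the decreasing affine binary plane tree with in-order reading $w$.) The affine sylvester congruence is $v\equiv_{\widetilde{\mathrm{syl}}}w\iff{\preceq_v}={\preceq_w}$; it is a semilattice congruence on $(\widetilde S_n,\leq_L)$ in which $\{e\}$ is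 a class, and each class has a unique $\leq_L$-minimal element. Let $\pi_\downarrow(w)$ be the minimal element of the class of $w$. The affine stack-sorting map is $\widetilde{\mathtt s}:\widetilde S_n\to\widetilde S_n$, $\widetilde{\mathtt s}(w)=w\,(\pi_\downarrow(w))^{ -1}$; every element is sent to $e$ by some iterate of $\widetilde{\mathtt s}$, and $\widetilde{\mathtt s}(e)=e$. The fertility of $w$ is $\lvert\widetilde{\mathtt s}^{ -1}(w)\rvert$, which is finite. The affine stack-sorting tree $\widetilde{\mathscr S}_n$ is the rooted tree with vertex set $\widetilde S_n$ and root $e$ in which the parent of each $w\neq e$ is $\widetilde{\mathtt s}(w)$. The subtree of $\widetilde{\mathscr S}_n$ with root $x$ is the rooted subtree with root $x$ and vertex set $\bigcup_{t\ge 0}\widetilde{\mathtt s}^{ -t}(x)$. -}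

module Defs where

open import Algebra.Bundles using (AbelianGroup; Group)
import Algebra.Properties.CommutativeMonoid.Sum as CommutativeMonoidSum
import Algebra.Properties.Group as GroupProperties
open import Data.Fin.Base using (Fin; toℕ; fromℕ<)
open import Data.Fin.Permutation using (Permutation′; permutation; _⟨$⟩ʳ_)
open import Data.Fin.Properties using (toℕ<n; toℕ-fromℕ<; toℕ-injective; toℕ-inject₁; toℕ-fromℕ)
open import Data.Integer.Base
  using (ℤ; +_; -[1+_]; _+_; _-_; _*_; -_; _⊖_; _⊓_; _⊔_; _≤_; _<_; 1ℤ; ∣_∣; _%ℕ_; _/ℕ_)
open import Data.Integer.DivMod using (n%ℕd<d; a≡a%ℕn+[a/ℕn]*n)
import Data.Integer.Properties as ℤ
open import Data.Integer.Tactic.RingSolver using (solve-∀)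
open import Data.Nat.Base as ℕ using (ℕ; zero; suc)
open import Data.Nat.Combinatorics using (_C_; nC1≡n; nCk+nC[k+1]≡[n+1]C[k+1])
open import Data.Nat.Divisibility using (divides; >⇒∤)
import Data.Nat.Properties as ℕ
open import Data.Product.Base using (∃-syntax; _×_; _,_; proj₁)
open import Function.Base using (_∘_; id)
open import Function.Bundles using (_↔_; _⇔_; Inverse)
open import Function.Construct.Composition using (_↔-∘_)
open import Function.Construct.Identity using (↔-id)
open import Function.Construct.Symmetry using (↔-sym)
open import Level using (0ℓ)
open import Relation.Binary.Bundles using (Setoid)
import Relation.Binary.Construct.On as On
open import Relation.Binary.Core using (Rel)
open import Relation.Binary.PropositionalEquality
  using (_≡_; _≢_; _≗_; refl; sym; trans; cong; cong₂; module ≡-Reasoning)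
open import Relation.Nullary.Negation using (¬_; contradiction)

open CommutativeMonoidSum ℤ.+-0-commutativeMonoid
  using (sum-syntax; ∑-distrib-+; sum-cong-≗; sum-init-last; ∑-permute)
open GroupProperties (AbelianGroup.group ℤ.+-0-abelianGroup) using () renaming (∙-cancelʳ to +-cancelʳ)

------------------------------------------------------------------------
-- Affine permutations

Periodic : ℕ → (ℤ → ℤ) → Set
Periodic n f = ∀ i → f (i + + n) ≡ f i + + n

-- f 1 + f 2 + ⋯ + f n
windowSum : ℕ → (ℤ → ℤ) → ℤ
windowSum n f = ∑[ k < n ] f (+ suc (toℕ k))

record AffinePermutation (n : ℕ) : Set where
  field
    bijection  : ℤ ↔ ℤ
  open Inverse bijection public
    using (to; from; strictlyInverseˡ; strictlyInverseʳ)
  field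
    periodic   : Periodic n to
    normalised : windowSum n to ≡ + (suc n C 2)

open AffinePermutation

infix 4 _≈_

_≈_ : ∀ {n} → Rel (AffinePermutation n) 0ℓ
v ≈ w = to v ≗ to w

------------------------------------------------------------------------
-- Closure of affine permutations under the group operations

periodic-multiple : ∀ n f → Periodic n f → ∀ i q → f (i + q * + n) ≡ f i + q * + n
periodic-multiple n f per i = λ { (+ k) → up k i ; -[1+ k ] → down (suc k) }
  where
  open ≡-Reasoning
  step : ∀ a b c → a + (1ℤ + b) * c ≡ (a + b * c) + c
  step = solve-∀
  undo : ∀ a b c → a ≡ (a + b * c) + (- b) * c
  undo = solve-∀
  redo : ∀ a b c → (a + (- b) * c) + b * c ≡ a
  redo = solve-∀
  up : ∀ k i → f (i + + k * + n) ≡ f i + + k * + n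
  up zero    i = trans (cong f (ℤ.+-identityʳ i)) (sym (ℤ.+-identityʳ (f i)))
  up (suc k) i = begin
    f (i + + suc k * + n)      ≡⟨ cong f (step i (+ k) (+ n)) ⟩
    f ((i + + k * + n) + + n)  ≡⟨ per _ ⟩
    f (i + + k * + n) + + n    ≡⟨ cong (_+ + n) (up k i) ⟩
    (f i + + k * + n) + + n    ≡⟨ step (f i) (+ k) (+ n) ⟨
    f i + + suc k * + n        ∎
  down : ∀ k → f (i + (- (+ k)) * + n) ≡ f i + (- (+ k)) * + n
  down k = begin
    f j                                      ≡⟨ undo (f j) (+ k) (+ n) ⟩
    (f j + + k * + n) + (- (+ k)) * + n      ≡⟨ cong (_+ (- (+ k)) * + n) (up k j) ⟨
    f (j + + k * + n) + (- (+ k)) * + n      ≡⟨ cong (λ x → f x + (- (+ k)) * + n) (redo i (+ k) (+ n)) ⟩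
    f i + (- (+ k)) * + n                    ∎
    where j = i + (- (+ k)) * + n

periodic-inverse : ∀ {n} (w : AffinePermutation n) → Periodic n (from w)
periodic-inverse {n} w i = begin
  from w (i + + n)                ≡⟨ cong (λ j → from w (j + + n)) (strictlyInverseˡ w i) ⟨
  from w (to w (from w i) + + n)  ≡⟨ cong (from w) (periodic w (from w i)) ⟨
  from w (to w (from w i + + n))  ≡⟨ strictlyInverseʳ w _ ⟩
  from w i + + n                  ∎
  where open ≡-Reasoning

-- Integers decompose uniquely as position k + q n with position k ∈ {1 , … , n}.

position : ∀ {n} → Fin n → ℤ
position k = + suc (toℕ k)

module _ {n : ℕ} .{{_ : ℕ.NonZero n}} where

  residue : ℤ → Fin n
  residue i = fromℕ< (n%ℕd<d (i - 1ℤ) n)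

  quotient : ℤ → ℤ
  quotient i = (i - 1ℤ) /ℕ n

  decompose : ∀ i → i ≡ position (residue i) + quotient i * + n
  decompose i = begin
    i                                                      ≡⟨ shift i ⟩
    1ℤ + (i - 1ℤ)                                          ≡⟨ cong (λ j → 1ℤ + j) (a≡a%ℕn+[a/ℕn]*n (i - 1ℤ) n) ⟩
    1ℤ + (+ ((i - 1ℤ) %ℕ n) + quotient i * + n)            ≡⟨ ℤ.+-assoc 1ℤ (+ ((i - 1ℤ) %ℕ n)) (quotient i * + n) ⟨
    + suc ((i - 1ℤ) %ℕ n) + quotient i * + n               ≡⟨ cong (λ r → + suc r + quotient i * + n) (toℕ-fromℕ< (n%ℕd<d (i - 1ℤ) n)) ⟨
    position (residue i) + quotient i * + n                ∎
    where
    open ≡-Reasoning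
    shift : ∀ i → i ≡ 1ℤ + (i - 1ℤ)
    shift = solve-∀

  decompose-unique : ∀ (k l : Fin n) p q →
                     position k + p * + n ≡ position l + q * + n → k ≡ l
  decompose-unique k l p q eq = toℕ-injective (ℕ.∣m-n∣≡0⇒m≡n distance≡0)
    where
    open ≡-Reasoning
    a = toℕ k
    b = toℕ l
    rearrange : ∀ x y p q m → (1ℤ + x) + p * m ≡ (1ℤ + y) + q * m → x - y ≡ (q - p) * m
    rearrange x y p q m e = begin
      x - y                                              ≡⟨ lhs x y p m ⟩
      ((1ℤ + x) + p * m) - ((1ℤ + y) + p * m)            ≡⟨ cong (_- ((1ℤ + y) + p * m)) e ⟩
      ((1ℤ + y) + q * m) - ((1ℤ + y) + p * m)            ≡⟨ rhs y p q m ⟩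
      (q - p) * m                                        ∎
      where
      lhs : ∀ x y p m → x - y ≡ ((1ℤ + x) + p * m) - ((1ℤ + y) + p * m)
      lhs = solve-∀
      rhs : ∀ y p q m → ((1ℤ + y) + q * m) - ((1ℤ + y) + p * m) ≡ (q - p) * m
      rhs = solve-∀
    distance : ℕ.∣ a - b ∣ ≡ ∣ q - p ∣ ℕ.* n
    distance = begin
      ℕ.∣ a - b ∣         ≡⟨ ∣⊖∣ a b ⟨
      ∣ a ⊖ b ∣           ≡⟨ cong ∣_∣ (ℤ.m-n≡m⊖n a b) ⟨
      ∣ + a - + b ∣       ≡⟨ cong ∣_∣ (rearrange (+ a) (+ b) p q (+ n) eq) ⟩
      ∣ (q - p) * + n ∣   ≡⟨ ℤ.abs-* (q - p) (+ n) ⟩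
      ∣ q - p ∣ ℕ.* n     ∎
      where
      ∣⊖∣ : ∀ a b → ∣ a ⊖ b ∣ ≡ ℕ.∣ a - b ∣
      ∣⊖∣ zero    zero    = refl
      ∣⊖∣ zero    (suc b) = refl
      ∣⊖∣ (suc a) zero    = refl
      ∣⊖∣ (suc a) (suc b) = trans (cong ∣_∣ (ℤ.[1+m]⊖[1+n]≡m⊖n a b)) (∣⊖∣ a b)
    distance<n : ℕ.∣ a - b ∣ ℕ.< n
    distance<n = ℕ.≤-<-trans (ℕ.∣m-n∣≤m⊔n a b) (ℕ.⊔-lub (toℕ<n k) (toℕ<n l))
    distance≡0 : ℕ.∣ a - b ∣ ≡ 0
    distance≡0 with ℕ.∣ a - b ∣ in e
    ... | zero  = refl
    ... | suc d = contradiction (divides ∣ q - p ∣ (trans (sym e) distance))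
                    (>⇒∤ (ℕ.≤-trans (ℕ.≤-reflexive (cong suc (sym e))) distance<n))

  residue-shift : ∀ k q → residue (position k + q * + n) ≡ k
  residue-shift k q = sym (decompose-unique k _ q (quotient i) (decompose i))
    where i = position k + q * + n

  residuePermutation : AffinePermutation n → Permutation′ n
  residuePermutation w = permutation
    (residue ∘ to w ∘ position) (residue ∘ from w ∘ position)
    (cancel (to w) (from w) (periodic w) (strictlyInverseˡ w))
    (cancel (from w) (to w) (periodic-inverse w) (strictlyInverseʳ w))
    where
    open ≡-Reasoning
    isolate : ∀ i → position (residue i) ≡ i + (- quotient i) * + n
    isolate i = trans (identity _ (quotient i) (+ n))
                      (cong (_+ (- quotient i) * + n) (sym (decompose i)))
      where
      identity : ∀ r q m → r ≡ (r + q * m) + (- q) * m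
      identity = solve-∀
    cancel : ∀ f g → Periodic n f → (∀ i → f (g i) ≡ i) →
             ∀ k → residue (f (position (residue (g (position k))))) ≡ k
    cancel f g per fg k = begin
      residue (f (position (residue i)))               ≡⟨ cong (residue ∘ f) (isolate i) ⟩
      residue (f (i + (- quotient i) * + n))           ≡⟨ cong residue (periodic-multiple n f per i (- quotient i)) ⟩
      residue (f i + (- quotient i) * + n)             ≡⟨ cong (λ j → residue (j + (- quotient i) * + n)) (fg (position k)) ⟩
      residue (position k + (- quotient i) * + n)      ≡⟨ residue-shift k (- quotient i) ⟩
      k                                                ∎
      where i = g (position k)

windowSum-∘ : ∀ n f → Periodic n f → (w : AffinePermutation n) →
              windowSum n (f ∘ to w) + windowSum n id ≡ windowSum n f + windowSum n (to w)
windowSum-∘ zero        f per w = refl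
windowSum-∘ n@(suc _) f per w = begin
  windowSum n (f ∘ to w) + windowSum n id
    ≡⟨ cong (λ x → windowSum n (f ∘ to w) + x) (∑-permute position π) ⟩
  windowSum n (f ∘ to w) + ∑[ k < n ] position (π ⟨$⟩ʳ k)
    ≡⟨ ∑-distrib-+ {n} (f ∘ to w ∘ position) (λ k → position (π ⟨$⟩ʳ k)) ⟨
  ∑[ k < n ] (f (to w (position k)) + position (π ⟨$⟩ʳ k))
    ≡⟨ sum-cong-≗ {n} (λ k → pointwise (to w (position k))) ⟩
  ∑[ k < n ] (f (position (π ⟨$⟩ʳ k)) + to w (position k))
    ≡⟨ ∑-distrib-+ {n} (λ k → f (position (π ⟨$⟩ʳ k))) (to w ∘ position) ⟩
  ∑[ k < n ] f (position (π ⟨$⟩ʳ k)) + windowSum n (to w)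
    ≡⟨ cong (_+ windowSum n (to w)) (∑-permute (f ∘ position) π) ⟨
  windowSum n f + windowSum n (to w)
    ∎
  where
  open ≡-Reasoning
  π = residuePermutation w
  pointwise : ∀ i → f i + position (residue {n} i) ≡ f (position (residue {n} i)) + i
  pointwise i = begin
    f i + r               ≡⟨ cong (λ j → f j + r) (decompose i) ⟩
    f (r + q * + n) + r   ≡⟨ cong (_+ r) (periodic-multiple n f per r q) ⟩
    (f r + q * + n) + r   ≡⟨ swap (f r) (q * + n) r ⟩
    f r + (r + q * + n)   ≡⟨ cong (λ j → f r + j) (decompose i) ⟨
    f r + i               ∎
    where
    r = position (residue {n} i)
    q = quotient {n} i
    swap : ∀ a b c → (a + b) + c ≡ a + (c + b)
    swap = solve-∀

windowSum-id : ∀ n → windowSum n id ≡ + (suc n C 2)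
windowSum-id zero    = refl
windowSum-id (suc n) = begin
  windowSum (suc n) id            ≡⟨ sum-init-last (position {suc n}) ⟩
  _                               ≡⟨ cong₂ _+_
                                       (sum-cong-≗ {n} (λ k → cong (λ m → + suc m) (toℕ-inject₁ k)))
                                       (cong (λ m → + suc m) (toℕ-fromℕ n)) ⟩
  windowSum n id + + suc n        ≡⟨ cong (_+ + suc n) (windowSum-id n) ⟩
  + (suc n C 2 ℕ.+ suc n)         ≡⟨ cong +_ (ℕ.+-comm (suc n C 2) (suc n)) ⟩
  + (suc n ℕ.+ suc n C 2)         ≡⟨ cong (λ m → + (m ℕ.+ suc n C 2)) (nC1≡n (suc n)) ⟨
  + (suc n C 1 ℕ.+ suc n C 2)     ≡⟨ cong +_ (nCk+nC[k+1]≡[n+1]C[k+1] (suc n) 1) ⟩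
  + (suc (suc n) C 2)             ∎
  where open ≡-Reasoning

------------------------------------------------------------------------
-- The affine symmetric group

infixl 7 _∙_
infix  8 _⁻¹

ε : ∀ {n} → AffinePermutation n
ε {n} = record
  { bijection  = ↔-id ℤ
  ; periodic   = λ _ → refl
  ; normalised = windowSum-id n
  }

_∙_ : ∀ {n} → AffinePermutation n → AffinePermutation n → AffinePermutation n
_∙_ {n} v w = record
  { bijection  = bijection v ↔-∘ bijection w
  ; periodic   = λ i → trans (cong (to v) (periodic w i)) (periodic v (to w i))
  ; normalised = +-cancelʳ (windowSum n id) (windowSum n (to v ∘ to w)) (+ (suc n C 2)) (begin
      windowSum n (to v ∘ to w) + windowSum n id  ≡⟨ windowSum-∘ n (to v) (periodic v) w ⟩
      windowSum n (to v) + windowSum n (to w)     ≡⟨ cong₂ _+_ (normalised v) (trans (normalised w) (sym (windowSum-id n))) ⟩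
      + (suc n C 2) + windowSum n id              ∎)
  }
  where open ≡-Reasoning

_⁻¹ : ∀ {n} → AffinePermutation n → AffinePermutation n
_⁻¹ {n} w = record
  { bijection  = ↔-sym (bijection w)
  ; periodic   = periodic-inverse w
  ; normalised = +-cancelʳ (windowSum n (to w)) (windowSum n (from w)) (+ (suc n C 2)) (begin
      windowSum n (from w) + windowSum n (to w)        ≡⟨ windowSum-∘ n (from w) (periodic-inverse w) w ⟨
      windowSum n (from w ∘ to w) + windowSum n id     ≡⟨ cong₂ _+_ (sum-cong-≗ {n} (strictlyInverseʳ w ∘ position)) (windowSum-id n) ⟩
      windowSum n id + + (suc n C 2)                   ≡⟨ cong₂ _+_ (windowSum-id n) (sym (normalised w)) ⟩
      + (suc n C 2) + windowSum n (to w)               ∎)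
  }
  where open ≡-Reasoning

affineSymmetricGroup : ℕ → Group 0ℓ 0ℓ
affineSymmetricGroup n = record
  { Carrier = AffinePermutation n
  ; _≈_     = _≈_
  ; _∙_     = _∙_
  ; ε       = ε
  ; _⁻¹     = _⁻¹
  ; isGroup = record
    { isMonoid = record
      { isSemigroup = record
        { isMagma = record
          { isEquivalence = record
            { refl  = λ _ → refl
            ; sym   = λ v≈w i → sym (v≈w i)
            ; trans = λ u≈v v≈w i → trans (u≈v i) (v≈w i)
            }
          ; ∙-cong = λ {u} {v} {w} {x} u≈v w≈x i → trans (cong (to u) (w≈x i)) (u≈v (to x i))
          }
        ; assoc = λ _ _ _ _ → refl
        }
      ; identity = (λ _ _ → refl) , (λ _ _ → refl)
      }
    ; inverse = strictlyInverseʳ , strictlyInverseˡ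
    ; ⁻¹-cong = λ {v} {w} v≈w i → begin
        from v i                  ≡⟨ cong (from v) (strictlyInverseˡ w i) ⟨
        from v (to w (from w i))  ≡⟨ cong (from v) (v≈w (from w i)) ⟨
        from v (to v (from w i))  ≡⟨ strictlyInverseʳ v (from w i) ⟩
        from w i                  ∎
    }
  }
  where open ≡-Reasoning

affinePermutationSetoid : ℕ → Setoid 0ℓ 0ℓ
affinePermutationSetoid n = Group.setoid (affineSymmetricGroup n)

------------------------------------------------------------------------
-- Coxeter length and left weak order

-- s is the simple generator s̃ᵢ.  For n = 1 the fields swap⁺ and swap⁻
-- contradict each other, so that the trivial group has no generators.
record IsSimple {n} (i : Fin n) (s : AffinePermutation n) : Set where
  field
    swap⁺ : ∀ m → to s (position i + m * + n) ≡ position i + m * + n + 1ℤ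
    swap⁻ : ∀ m → to s (position i + m * + n + 1ℤ) ≡ position i + m * + n
    fixed : ∀ j → (∀ m → j ≢ position i + m * + n) →
                  (∀ m → j ≢ position i + m * + n + 1ℤ) → to s j ≡ j

IsProductOfSimples : ∀ {n} → ℕ → AffinePermutation n → Set
IsProductOfSimples zero    w = w ≈ ε
IsProductOfSimples (suc k) w =
  ∃[ i ] ∃[ s ] ∃[ w′ ] IsSimple i s × w ≈ s ∙ w′ × IsProductOfSimples k w′

-- The graph of the Coxeter length ℓ.
HasLength : ∀ {n} → AffinePermutation n → ℕ → Set
HasLength w k = IsProductOfSimples k w × (∀ l → IsProductOfSimples l w → k ℕ.≤ l)

infix 4 _≤L_

_≤L_ : ∀ {n} → Rel (AffinePermutation n) 0ℓ
x ≤L y = ∃[ a ] ∃[ b ] ∃[ c ]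
  HasLength x a × HasLength y b × HasLength (y ∙ x ⁻¹) c × + c ≡ + b - + a

------------------------------------------------------------------------
-- The affine sylvester congruence

-- The positions i and j, in either order, are incomparable in ⪯_w.
Incomparable : ∀ {n} → AffinePermutation n → Rel ℤ 0ℓ
Incomparable w i j = ∃[ k ] i ⊓ j < k × k < i ⊔ j × to w i ⊔ to w j < to w k

infix 4 _⪯[_]_ _≡syl_

_⪯[_]_ : ∀ {n} → ℤ → AffinePermutation n → ℤ → Set
i ⪯[ w ] j = ¬ Incomparable w i j × to w i ≤ to w j

_≡syl_ : ∀ {n} → Rel (AffinePermutation n) 0ℓ
v ≡syl w = ∀ i j → i ⪯[ v ] j ⇔ i ⪯[ w ] j

------------------------------------------------------------------------
-- The affine stack-sorting map

-- The graph of π↓: p is the ≤L-minimal element of the class of w (every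
-- class has exactly one, so this relation is functional and total).
record IsMinimalRepresentative {n} (p w : AffinePermutation n) : Set where
  field
    congruent : p ≡syl w
    minimal   : ∀ u → u ≡syl w → u ≤L p → u ≈ p

-- The graph of the affine stack-sorting map, which sends w to u.
StackSorts : ∀ {n} → Rel (AffinePermutation n) 0ℓ
StackSorts w u = ∃[ p ] IsMinimalRepresentative p w × u ≈ w ∙ p ⁻¹

StackSorts^ : ∀ {n} → ℕ → Rel (AffinePermutation n) 0ℓ
StackSorts^ zero    w u = w ≈ u
StackSorts^ (suc t) w u = ∃[ w′ ] StackSorts w w′ × StackSorts^ t w′ u

-- The set of preimages of w; its cardinality is the fertility of w.
fibre : ∀ {n} → AffinePermutation n → Setoid 0ℓ 0ℓ
fibre {n} w = On.setoid (affinePermutationSetoid n) (proj₁ {B = λ u → StackSorts u w})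

-- Finite sets have the same cardinality when there is a bijection
-- between them.
SameFertility : ∀ {n} → Rel (AffinePermutation n) 0ℓ
SameFertility v w = Inverse (fibre v) (fibre w)

------------------------------------------------------------------------
-- The affine stack-sorting tree

-- A rooted tree, given by its vertices, its root and its edges;
-- IsParent u v says that the parent of u is v.  The tree axioms are not
-- part of the record, as they play no role in the notion of isomorphism.
record RootedTree : Set₁ where
  field
    vertices : Setoid 0ℓ 0ℓ
  open Setoid vertices public using () renaming (Carrier to Vertex; _≈_ to _≈ᵥ_)
  field
    root     : Vertex
    IsParent : Rel Vertex 0ℓ

infix 4 _≅_

record _≅_ (S T : RootedTree) : Set where
  private
    module S = RootedTree S
    module T = RootedTree T
  field
    vertexBijection : Inverse S.vertices T.vertices
  open Inverse vertexBijection using () renaming (to to φ)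
  field
    preservesRoot   : φ S.root T.≈ᵥ T.root
    preservesParent : ∀ u v → S.IsParent u v ⇔ T.IsParent (φ u) (φ v)

stackSortingTree : ℕ → RootedTree
stackSortingTree n = record
  { vertices = affinePermutationSetoid n
  ; root     = ε
  ; IsParent = λ w u → ¬ (w ≈ ε) × StackSorts w u
  }

subtree : ∀ {n} → AffinePermutation n → RootedTree
subtree {n} x = record
  { vertices = On.setoid 𝒮.vertices (proj₁ {B = λ u → ∃[ t ] StackSorts^ t u x})
  ; root     = x , 0 , λ _ → refl
  ; IsParent = λ u v → 𝒮.IsParent (proj₁ u) (proj₁ v)
  }
  where module 𝒮 = RootedTree (stackSortingTree n)

-- For v ≡syl w the isomorphism is left translation by z = w v⁻¹.  A node u
-- with parent u′ is u = u′ p for the minimal element p of its class, and the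
-- key point is that z u′ ≡syl u′ implies z u′ p ≡syl p: then z u has parent
-- z u′, and one climbs the tree from v.
--
-- An element is congruent to p exactly when it is a decreasing labelling of
-- the tree of p.  If u′ p is one and z u′ p is not, then there are a < b,
-- labels of nodes i ⪯ j in p, whose order differs under u′ and z u′.  They are
-- incomparable for u′, so some c between them has u′(c) > u′(b).  But p labels
-- its tree in postorder, so c labels a node below j, which contradicts that
-- u′ p is a decreasing labelling.
--
-- That p is labelled in postorder follows from its minimality: otherwise
-- consecutive labels x, x + 1 of incomparable nodes are inverted, and swapping
-- them (with all their translates) stays in the class and shortens p.

module Submission where

open import Algebra.Bundles using (AbelianGroup; Group)
import Algebra.Properties.CommutativeMonoid.Sum as CommutativeMonoidSum
import Algebra.Properties.Group as GroupProperties
open import Data.Bool.Base using (if_then_else_)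
open import Data.Fin.Base using (Fin; toℕ; zero; suc)
open import Data.Fin.Permutation using (_⟨$⟩ʳ_)
import Data.Fin.Properties as Fin
open import Data.Integer.Base
  using (ℤ; +_; -[1+_]; _+_; _-_; _*_; -_; _⊓_; _⊔_; _≤_; _<_; 0ℤ; 1ℤ; -1ℤ; ∣_∣; _/ℕ_; +≤+; +<+)
open import Data.Integer.DivMod using ([n/ℕd]*d≤n; n<s[n/ℕd]*d)
import Data.Integer.Properties as ℤ
open import Data.Integer.Tactic.RingSolver using (solve-∀)
open import Data.Nat.Base as ℕ using (ℕ; zero; suc; NonZero)
open import Data.Nat.Combinatorics using (_C_)
open import Data.Nat.Divisibility using (divides; ∣1⇒≡1)
import Data.Nat.Properties as ℕ
open import Data.Product.Base using (∃-syntax; _×_; _,_; proj₁; proj₂)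
open import Data.Sum.Base using (inj₁; inj₂)
open import Defs
open import Function.Base using (_∘_; id; case_of_)
open import Function.Bundles using (_⇔_; mk⇔; mk↔ₛ′; Equivalence)
open import Level using (0ℓ)
open import Relation.Binary.Definitions using (tri<; tri≈; tri>)
open import Relation.Binary.PropositionalEquality
  using (_≡_; _≢_; _≗_; refl; sym; trans; cong; cong₂; subst; subst₂; module ≡-Reasoning)
open import Relation.Nullary using (¬_; contradiction; Dec; does; yes; no; _×-dec_)
open import Relation.Unary using (Pred; Decidable)

open AffinePermutation
open GroupProperties (AbelianGroup.group ℤ.+-0-abelianGroup) using () renaming (∙-cancelˡ to +-cancelˡ)

private
  module Sumℤ = CommutativeMonoidSum ℤ.+-0-commutativeMonoid
  module Sumℕ = CommutativeMonoidSum ℕ.+-0-commutativeMonoid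

open Sumℕ using (sum-syntax)

-- Discreteness of the integers and searches over finite ranges.

<⇒+1≤ : ∀ {i j} → i < j → i + 1ℤ ≤ j
<⇒+1≤ {i} i<j = subst (_≤ _) (ℤ.+-comm 1ℤ i) (ℤ.i<j⇒suc[i]≤j i<j)

+1≤⇒< : ∀ {i j} → i + 1ℤ ≤ j → i < j
+1≤⇒< {i} i+1≤j = ℤ.suc[i]≤j⇒i<j (subst (_≤ _) (ℤ.+-comm i 1ℤ) i+1≤j)

i<i+1 : ∀ i → i < i + 1ℤ
i<i+1 i = +1≤⇒< ℤ.≤-refl

<+1⇒≤ : ∀ {i j} → i < j + 1ℤ → i ≤ j
<+1⇒≤ {i} {j} i<j+1 = ℤ.≮⇒≥ λ j<i → ℤ.<-irrefl refl (ℤ.<-≤-trans i<j+1 (<⇒+1≤ j<i))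

≤⇒∃+ : ∀ {i j} → i ≤ j → ∃[ m ] j ≡ i + + m
≤⇒∃+ {i} {j} i≤j with j - i in eq | ℤ.i≤j⇒0≤j-i i≤j
... | + m | _ = m , trans (cancel i j) (cong (λ d → i + d) eq)
  where
  cancel : ∀ i j → j ≡ i + (j - i)
  cancel = solve-∀

+suc : ∀ i m → i + + suc m ≡ (i + + m) + 1ℤ
+suc i m = trans (cong (λ k → i + + k) (ℕ.+-comm 1 m)) (sym (ℤ.+-assoc i (+ m) 1ℤ))

+<+suc : ∀ i m → i + + m < i + + suc m
+<+suc i m = subst (i + + m <_) (sym (+suc i m)) (i<i+1 (i + + m))

extend-bound : (f : ℤ → ℤ) (c : ℤ) (m : ℕ) {y z : ℤ} → (∀ l → c ≤ l → l < c + + m → f l ≤ z) →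
               z ≤ y → f (c + + m) ≤ y → ∀ l → c ≤ l → l < c + + suc m → f l ≤ y
extend-bound f c m max z≤y last≤y l c≤l l< with l ℤ.≟ c + + m
... | yes refl = last≤y
... | no  l≢   = ℤ.≤-trans (max l c≤l (ℤ.≤∧≢⇒< (<+1⇒≤ (subst (l <_) (+suc c m) l<)) l≢)) z≤y

-- The candidate `k₀` may lie outside the range: it seeds the search, so that a maximiser satisfying
-- `P` exists even for an empty range.
argmax : (f : ℤ → ℤ) (P : Pred ℤ 0ℓ) (c : ℤ) (m : ℕ) →
         (∀ l → c ≤ l → l < c + + m → P l) → ∀ k₀ → P k₀ →
         ∃[ k ] P k × f k₀ ≤ f k × (∀ l → c ≤ l → l < c + + m → f l ≤ f k)
argmax f P c zero    _   k₀ Pk₀ = k₀ , Pk₀ , ℤ.≤-refl , λ l c≤l l<c →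
  contradiction (ℤ.<-≤-trans l<c (ℤ.≤-trans (ℤ.≤-reflexive (ℤ.+-identityʳ c)) c≤l)) (ℤ.<-irrefl refl)
argmax f P c (suc m) all k₀ Pk₀
  with argmax f P c m (λ l c≤l l<c+m → all l c≤l (ℤ.<-trans l<c+m (+<+suc c m))) k₀ Pk₀
... | k , Pk , k₀≤k , max with ℤ.≤-total (f (c + + m)) (f k)
...   | inj₁ last≤k = k , Pk , k₀≤k , extend-bound f c m max ℤ.≤-refl last≤k
...   | inj₂ k≤last = c + + m , all _ (ℤ.i≤i+j c (+ m)) (+<+suc c m) ,
  ℤ.≤-trans k₀≤k k≤last , extend-bound f c m max k≤last ℤ.≤-refl

-- A discrete intermediate value argument, scanning down from `b` until `P` holds.
crossing : {P : Pred ℤ 0ℓ} → Decidable P → ∀ {a b} → a ≤ b → P a → ¬ P b →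
           ∃[ x ] a ≤ x × x < b × P x × ¬ P (x + 1ℤ)
crossing {P} P? {a} a≤b Pa ¬Pb with ≤⇒∃+ a≤b
... | m , refl = go m ¬Pb
  where
  go : ∀ m → ¬ P (a + + m) → ∃[ x ] a ≤ x × x < a + + m × P x × ¬ P (x + 1ℤ)
  go zero    ¬P = contradiction (subst P (sym (ℤ.+-identityʳ a)) Pa) ¬P
  go (suc m) ¬P with P? (a + + m)
  ... | yes Pm = a + + m , ℤ.i≤i+j a (+ m) , +<+suc a m
                 , Pm , subst (¬_ ∘ P) (+suc a m) ¬P
  ... | no ¬Pm with go m ¬Pm
  ...   | x , a≤x , x< , Px , ¬Px+1 =
    x , a≤x , ℤ.<-trans x< (+<+suc a m) , Px , ¬Px+1

-- Equivalence laws of the congruence, and positions between two others.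

module _ {n : ℕ} where

  to-injective : (w : AffinePermutation n) → ∀ {i j} → to w i ≡ to w j → i ≡ j
  to-injective w {i} {j} eq =
    trans (sym (strictlyInverseʳ w i)) (trans (cong (from w) eq) (strictlyInverseʳ w j))

  ≡syl-sym : (v w : AffinePermutation n) → v ≡syl w → w ≡syl v
  ≡syl-sym v w v≡w i j = mk⇔ (Equivalence.from (v≡w i j)) (Equivalence.to (v≡w i j))

  ≡syl-trans : (u v w : AffinePermutation n) → u ≡syl v → v ≡syl w → u ≡syl w
  ≡syl-trans u v w u≡v v≡w i j =
    mk⇔ (Equivalence.to (v≡w i j) ∘ Equivalence.to (u≡v i j))
        (Equivalence.from (u≡v i j) ∘ Equivalence.from (v≡w i j))

Between : ℤ → ℤ → ℤ → Set
Between i k j = i ⊓ j < k × k < i ⊔ j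

between-sym : ∀ {i k j} → Between i k j → Between j k i
between-sym {i} {k} {j} (a , b) = subst (_< k) (ℤ.⊓-comm i j) a , subst (k <_) (ℤ.⊔-comm i j) b

between-< : ∀ {i k j} → i < k → k < j → Between i k j
between-< {i} {k} {j} i<k k<j = ℤ.≤-<-trans (ℤ.i⊓j≤i i j) i<k , ℤ.<-≤-trans k<j (ℤ.i≤j⊔i i j)

<-between : ∀ {i k j} → i ≤ j → Between i k j → i < k × k < j
<-between i≤j (a , b) = subst (_< _) (ℤ.i≤j⇒i⊓j≡i i≤j) a , subst (_ <_) (ℤ.i≤j⇒i⊔j≡j i≤j) b

between-trans : ∀ {i k l j} → Between i k j → Between i l k → Between i l j
between-trans {i} {k} {l} {j} (a , b) (c , d) =
  ℤ.≤-<-trans (ℤ.⊓-glb (ℤ.i⊓j≤i i j) (ℤ.<⇒≤ a)) c ,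
  ℤ.<-≤-trans d (ℤ.⊔-lub (ℤ.i≤i⊔j i j) (ℤ.<⇒≤ b))

⊔-< : ∀ {i j k} → i < k → j < k → i ⊔ j < k
⊔-< {i} {j} {k} i<k j<k with ℤ.⊔-sel i j
... | inj₁ eq = subst (_< k) (sym eq) i<k
... | inj₂ eq = subst (_< k) (sym eq) j<k

-- The descendant order of a single permutation.

module _ {n : ℕ} (w : AffinePermutation n) where

  incomparable-sym : ∀ {i j} → Incomparable w i j → Incomparable w j i
  incomparable-sym {i} {j} (k , a , b , c) =
    k , proj₁ (between-sym {i} {k} {j} (a , b)) , proj₂ (between-sym {i} {k} {j} (a , b)) ,
    subst (_< to w k) (ℤ.⊔-comm (to w i) (to w j)) c

  separated : ∀ {i k j} → Between i k j → to w i < to w k → to w j < to w k → Incomparable w i j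
  separated (a , b) c d = _ , a , b , ⊔-< c d

  -- The interval between a node and its ancestor `j` carries no value above that of `j`, since such
  -- a value would separate the two. A separator of `k` and `j` lies in that interval as well.
  between-⪯ : ∀ {i j k} → i ⪯[ w ] j → Between i k j → k ⪯[ w ] j
  between-⪯ {i} {j} {k} (comparable , i≤j) ikj = k≁j , ℤ.≮⇒≥ λ j<k →
    comparable (separated ikj (ℤ.≤-<-trans i≤j j<k) j<k)
    where
    k≁j : ¬ Incomparable w k j
    k≁j (l , a , b , c) = comparable (separated ilj (ℤ.≤-<-trans i≤j j<l) j<l)
      where
      jlk : Between j l k
      jlk = between-sym {k} {l} {j} (a , b)
      ilj : Between i l j
      ilj = between-sym {j} {l} {i} (between-trans {j} {k} {l} {i} (between-sym {i} {k} {j} ikj) jlk)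
      j<l = ℤ.≤-<-trans (ℤ.i≤j⊔i (to w k) (to w j)) c

  -- The largest value strictly between `i` and `j` sits at their lowest common ancestor: nothing in
  -- between exceeds it, so nothing separates it from either. Unlike a bare separator, this ancestor
  -- is expressed by `⪯`, so every decreasing labelling of the tree respects it.
  incomparable⇒⪯ : ∀ {i j} → Incomparable w i j →
    ∃[ k ] Between i k j × to w i < to w k × to w j < to w k × i ⪯[ w ] k × j ⪯[ w ] k
  incomparable⇒⪯ {i} {j} (k₀ , a , b , c)
    with ≤⇒∃+ (<⇒+1≤ (ℤ.<-trans a b))
  -- The half-open range starts at `i ⊓ j + 1ℤ` and has length `m`, so it is exactly the open
  -- interval between the two positions.
  ... | m , i⊔j≡ with argmax (to w) (λ k → Between i k j) (i ⊓ j + 1ℤ) m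
                        (λ l c≤l l< → +1≤⇒< c≤l , subst (l <_) (sym i⊔j≡) l<) k₀ (a , b)
  ... | k , ikj , k₀≤k , max =
    k , ikj , i<k , j<k , (i∼k , ℤ.<⇒≤ i<k) , (j∼k , ℤ.<⇒≤ j<k)
    where
    max′ : ∀ l → Between i l j → to w l ≤ to w k
    max′ l (a , b) = max l (<⇒+1≤ a) (subst (l <_) i⊔j≡ b)
    c′ = ℤ.<-≤-trans c k₀≤k
    i<k = ℤ.≤-<-trans (ℤ.i≤i⊔j (to w i) (to w j)) c′
    j<k = ℤ.≤-<-trans (ℤ.i≤j⊔i (to w i) (to w j)) c′
    i∼k : ¬ Incomparable w i k
    i∼k (l , d , e , f) = ℤ.<-irrefl refl (ℤ.≤-<-trans (ℤ.i≤j⊔i (to w i) (to w k))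
      (ℤ.<-≤-trans f (max′ l (between-trans {i} {k} {l} {j} ikj (d , e)))))
    j∼k : ¬ Incomparable w j k
    j∼k (l , d , e , f) = ℤ.<-irrefl refl (ℤ.≤-<-trans (ℤ.i≤j⊔i (to w j) (to w k))
      (ℤ.<-≤-trans f (max′ l (between-sym {j} {l} {i}
        (between-trans {j} {k} {l} {i} (between-sym {i} {k} {j} ikj) (d , e))))))

-- Decreasing labellings and the postorder property.

module _ {n : ℕ} where

  -- Monotonicity along `⪯[ p ]` pins down the whole order. Comparable nodes of `p` stay comparable
  -- because everything between them is a descendant of the upper one; incomparable nodes stay
  -- incomparable because their lowest common ancestor in `p` keeps a strictly larger label.
  labelling⇒≡syl : (u p : AffinePermutation n) →
                   (∀ i j → i ⪯[ p ] j → to u i ≤ to u j) → u ≡syl p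
  labelling⇒≡syl u p mono i j = mk⇔ u⇒p p⇒u
    where
    strict : ∀ {i j} → i ⪯[ p ] j → to p i < to p j → to u i < to u j
    strict i⪯j i<j = ℤ.≤∧≢⇒< (mono _ _ i⪯j) λ eq →
      ℤ.<-irrefl (cong (to p) (to-injective u eq)) i<j
    p⇒u : i ⪯[ p ] j → i ⪯[ u ] j
    p⇒u i⪯j = (λ { (k , a , b , c) → ℤ.<-irrefl refl
      (ℤ.<-≤-trans (ℤ.≤-<-trans (ℤ.i≤j⊔i (to u i) (to u j)) c) (mono k j (between-⪯ p i⪯j (a , b)))) })
      , mono i j i⪯j
    u⇒p : i ⪯[ u ] j → i ⪯[ p ] j
    u⇒p (comparable , ui≤uj) = i∼j , pi≤pj
      where
      i∼j : ¬ Incomparable p i j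
      i∼j inc with incomparable⇒⪯ p inc
      ... | k , ikj , i<k , j<k , i⪯k , j⪯k =
        comparable (separated u ikj (strict i⪯k i<k) (strict j⪯k j<k))
      pi≤pj : to p i ≤ to p j
      pi≤pj = ℤ.≮⇒≥ λ pj<pi → ℤ.<-irrefl refl (ℤ.<-≤-trans
        (strict ((λ inc → i∼j (incomparable-sym p inc)) , ℤ.<⇒≤ pj<pi) pj<pi) ui≤uj)

  ≈⇒≡syl : (v w : AffinePermutation n) → v ≈ w → v ≡syl w
  ≈⇒≡syl v w v≈w = labelling⇒≡syl v w λ i j i⪯j →
    subst₂ _≤_ (sym (v≈w i)) (sym (v≈w j)) (proj₂ i⪯j)

  -- The tree of p is labelled in postorder.
  IncomparableIncreasing : AffinePermutation n → Set
  IncomparableIncreasing p = ∀ {i j} → i < j → Incomparable p i j → to p i < to p j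

  -- The congruence transfers the relation `⪯[ v ]`, not a mere comparison of values, so for
  -- `i ⪯[ p ] j` the labels of `i` and `j` must first be shown comparable in `v`.
  IncomparableIncreasing-∙ : (v w p : AffinePermutation n) → IncomparableIncreasing p →
    v ≡syl w → v ∙ p ≡syl p → w ∙ p ≡syl p
  IncomparableIncreasing-∙ v w p postorder v≡w vp≡p =
    labelling⇒≡syl (w ∙ p) p λ i j i⪯j →
      proj₂ (Equivalence.to (v≡w (to p i) (to p j)) (v-below i⪯j , v-mono i⪯j))
    where
    v-mono : ∀ {i j} → i ⪯[ p ] j → to v (to p i) ≤ to v (to p j)
    v-mono {i} {j} i⪯j = proj₂ (Equivalence.from (vp≡p i j) i⪯j)
    -- In a postorder labelling, the labels between those of a node and of
    -- a descendant of it are labels of descendants.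
    v-below : ∀ {i j} → i ⪯[ p ] j → ¬ Incomparable v (to p i) (to p j)
    v-below {i} {j} i⪯j@(comparable , a≤b) (c , a<c<b₁ , a<c<b₂ , v<vc)
      with <-between a≤b (a<c<b₁ , a<c<b₂)
    ... | a<c , c<b = ℤ.<-irrefl refl (ℤ.<-≤-trans vb<vc vc≤vb)
      where
      k = from p c
      pk≡c : to p k ≡ c
      pk≡c = strictlyInverseˡ p c
      pi<pk : to p i < to p k
      pi<pk = subst (to p i <_) (sym pk≡c) a<c
      pk<pj : to p k < to p j
      pk<pj = subst (_< to p j) (sym pk≡c) c<b
      vb<vc : to v (to p j) < to v c
      vb<vc = ℤ.≤-<-trans (ℤ.i≤j⊔i (to v (to p i)) (to v (to p j))) v<vc
      k∼j : ¬ Incomparable p k j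
      k∼j inc@(m , d , e , f) with ℤ.<-cmp k j
      ... | tri≈ _ k≡j _ = ℤ.<-irrefl (cong (to p) k≡j) pk<pj
      ... | tri> _ _ j<k = ℤ.<-asym pk<pj (postorder j<k (incomparable-sym p inc))
      -- `m` separates `k` from `j`, and `i` is compared with it. If `i < m`, then `m` separates `i`
      -- from `j` too; if `i = m`, then `i` has a larger label than `j`; if `m < i`, then `m`
      -- separates `k` from `i`, and postorder gives `k` the smaller label, against `pi<pk`.
      ... | tri< k<j _ _ with <-between (ℤ.<⇒≤ k<j) (d , e) | ℤ.<-cmp i m
      ... | k<m , m<j | tri< i<m _ _ = comparable (separated p (between-< i<m m<j) (ℤ.≤-<-trans a≤b pj<pm) pj<pm)
        where pj<pm = ℤ.≤-<-trans (ℤ.i≤j⊔i (to p k) (to p j)) f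
      ... | k<m , m<j | tri≈ _ refl _ = ℤ.<-irrefl refl (ℤ.≤-<-trans a≤b pj<pm)
        where pj<pm = ℤ.≤-<-trans (ℤ.i≤j⊔i (to p k) (to p j)) f
      ... | k<m , m<j | tri> _ _ m<i = ℤ.<-asym pi<pk
        (postorder (ℤ.<-trans k<m m<i) (separated p (between-< k<m m<i)
          (ℤ.≤-<-trans (ℤ.i≤i⊔j (to p k) (to p j)) f) (ℤ.≤-<-trans a≤b pj<pm)))
        where pj<pm = ℤ.≤-<-trans (ℤ.i≤j⊔i (to p k) (to p j)) f
      vc≤vb : to v c ≤ to v (to p j)
      vc≤vb = subst (λ x → to v x ≤ to v (to p j)) pk≡c (v-mono (k∼j , ℤ.<⇒≤ pk<pj))

  -- Let `k` separate `i < j` although `j` has the smaller label. As the label runs from `to p j` to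
  -- `to p i`, the position carrying it passes from the right of `k` to the left, so two consecutive
  -- labels sit on opposite sides of `k`. Both are below the label of `k`, hence `k` separates their
  -- positions, which form an excluded inversion.
  ¬inversion⇒postorder : (p : AffinePermutation n) →
    (∀ x → from p (x + 1ℤ) < from p x → ¬ Incomparable p (from p (x + 1ℤ)) (from p x)) →
    IncomparableIncreasing p
  ¬inversion⇒postorder p no-inversion {i} {j} i<j (k , a , b , c)
    with <-between (ℤ.<⇒≤ i<j) (a , b) | ℤ.<-cmp (to p i) (to p j)
  ... | i<k , k<j | tri< pi<pj _ _ = pi<pj
  ... | i<k , k<j | tri≈ _ pi≡pj _ = contradiction i<j (ℤ.<-irrefl (to-injective p pi≡pj))
  ... | i<k , k<j | tri> _ _ pj<pi
    with crossing (λ x → k ℤ.<? from p x) (ℤ.<⇒≤ pj<pi)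
           (subst (k <_) (sym (strictlyInverseʳ p j)) k<j)
           (λ k<i → ℤ.<-asym i<k (subst (k <_) (strictlyInverseʳ p i) k<i))
  ... | x , pj≤x , x<pi , k<gx , k≮gx+1 = contradiction
    (separated p (between-< gx+1<k k<gx) (subst (_< to p k) (sym (strictlyInverseˡ p _)) x+1<pk)
                                          (subst (_< to p k) (sym (strictlyInverseˡ p x)) (ℤ.<-trans x<pi pi<pk)))
    (no-inversion x (ℤ.<-trans gx+1<k k<gx))
    where
    pi<pk = ℤ.≤-<-trans (ℤ.i≤i⊔j (to p i) (to p j)) c
    x+1<pk : x + 1ℤ < to p k
    x+1<pk = ℤ.≤-<-trans (<⇒+1≤ x<pi) pi<pk
    -- Failing the predicate only puts this position at or left of `k`; it differs from `k` because
    -- its label is smaller.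
    gx+1<k : from p (x + 1ℤ) < k
    gx+1<k = ℤ.≤∧≢⇒< (ℤ.≮⇒≥ k≮gx+1) λ eq →
      ℤ.<-irrefl (trans (sym (strictlyInverseˡ p (x + 1ℤ))) (cong (to p) eq)) x+1<pk

-- Finite sums and monotone integer functions.

sum-const : ∀ n c → Sumℤ.sum {n} (λ _ → c) ≡ + n * c
sum-const zero    c = refl
sum-const (suc n) c = trans (cong (λ x → c + x) (sum-const n c)) (step (+ n) c)
  where
  step : ∀ m c → c + m * c ≡ (1ℤ + m) * c
  step = solve-∀

telescope : ∀ n (f : ℕ → ℤ) → Sumℤ.sum {n} (λ k → f (suc (toℕ k)) - f (toℕ k)) ≡ f n - f 0
telescope zero    f = sym (ℤ.+-inverseʳ (f 0))
telescope (suc n) f = trans (cong (λ x → (f 1 - f 0) + x) (telescope n (f ∘ suc))) (step (f 0) (f 1) (f (suc n)))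
  where
  step : ∀ a b c → (b - a) + (c - b) ≡ c - a
  step = solve-∀

monotone : (f : ℤ → ℤ) → (∀ j → f j ≤ f (j + 1ℤ)) → ∀ {i j} → i ≤ j → f i ≤ f j
monotone f step {i} i≤j with ≤⇒∃+ i≤j
... | m , refl = go m
  where
  go : ∀ m → f i ≤ f (i + + m)
  go zero    = ℤ.≤-reflexive (cong f (sym (ℤ.+-identityʳ i)))
  go (suc m) = subst (λ j → f i ≤ f j) (sym (+suc i m)) (ℤ.≤-trans (go m) (step _))

δ : ∀ {n} → Fin n → Fin n → ℕ
δ zero    zero    = 1
δ zero    (suc _) = 0
δ (suc _) zero    = 0
δ (suc k) (suc l) = δ k l

δ-refl : ∀ {n} (k : Fin n) → δ k k ≡ 1
δ-refl zero    = refl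
δ-refl (suc k) = δ-refl k

δ-≢ : ∀ {n} {k l : Fin n} → k ≢ l → δ k l ≡ 0
δ-≢ {k = zero}  {zero}  k≢l = contradiction refl k≢l
δ-≢ {k = zero}  {suc _} _   = refl
δ-≢ {k = suc _} {zero}  _   = refl
δ-≢ {k = suc _} {suc _} k≢l = δ-≢ (k≢l ∘ cong suc)

∑-δ : ∀ {n} (k : Fin n) c → ∑[ l < n ] (δ k l ℕ.* c) ≡ c
∑-δ {suc n} zero    c = trans (cong₂ ℕ._+_ (ℕ.+-identityʳ c) (Sumℕ.sum-replicate-zero n)) (ℕ.+-identityʳ c)
∑-δ {suc n} (suc k) c = ∑-δ k c

-- Monotone affine permutations and residue classes.

module _ {n : ℕ} .{{_ : NonZero n}} where

  -- A monotone bijection of the integers rises by exactly one at each step, so it is a translation;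
  -- the normalised window sum forces the shift to be zero.
  monotone⇒≈ε : (w : AffinePermutation n) → (∀ {i j} → i ≤ j → to w i ≤ to w j) → w ≈ ε
  monotone⇒≈ε w mono i = begin
    to w i                                                   ≡⟨ cong (to w) (decompose {n} i) ⟩
    to w (position (residue {n} i) + quotient {n} i * + n)
      ≡⟨ periodic-multiple n (to w) (periodic w) (position (residue {n} i)) (quotient {n} i) ⟩
    to w (position (residue {n} i)) + quotient {n} i * + n
      ≡⟨ cong (_+ quotient {n} i * + n) (fixed (residue {n} i)) ⟩
    position (residue {n} i) + quotient {n} i * + n          ≡⟨ decompose {n} i ⟨
    i                                                        ∎
    where
    open ≡-Reasoning
    -- The integer mapped to `to w j + 1ℤ` must lie beyond `j`, so `j + 1ℤ` cannot be sent higher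
    -- than that value.
    successor : ∀ j → to w (j + 1ℤ) ≡ to w j + 1ℤ
    successor j = ℤ.≤-antisym
      (ℤ.≤-trans (mono (<⇒+1≤ (ℤ.≰⇒> λ k≤j →
                    ℤ.<-irrefl refl (ℤ.<-≤-trans (i<i+1 (to w j)) (subst (_≤ to w j) wk≡ (mono k≤j))))))
                 (ℤ.≤-reflexive wk≡))
      (<⇒+1≤ (ℤ.≤∧≢⇒< (mono (ℤ.<⇒≤ (i<i+1 j))) λ eq → ℤ.<-irrefl (to-injective w eq) (i<i+1 j)))
      where
      wk≡ : to w (from w (to w j + 1ℤ)) ≡ to w j + 1ℤ
      wk≡ = strictlyInverseˡ w _
    c = to w 0ℤ
    translation : ∀ m → to w (+ m) ≡ + m + c
    translation zero    = sym (ℤ.+-identityˡ c)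
    translation (suc m) = begin
      to w (+ suc m)        ≡⟨ cong (λ x → to w (+ x)) (ℕ.+-comm 1 m) ⟩
      to w (+ m + 1ℤ)       ≡⟨ successor (+ m) ⟩
      to w (+ m) + 1ℤ       ≡⟨ cong (_+ 1ℤ) (translation m) ⟩
      + m + c + 1ℤ          ≡⟨ rearrange (+ m) c ⟩
      1ℤ + + m + c          ∎
      where
      rearrange : ∀ m c → m + c + 1ℤ ≡ 1ℤ + m + c
      rearrange = solve-∀
    nc≡0 : + n * c ≡ 0ℤ
    nc≡0 = +-cancelˡ (windowSum n id) _ _ (begin
      windowSum n id + + n * c                       ≡⟨ cong (λ x → windowSum n id + x) (sum-const n c) ⟨
      windowSum n id + Sumℤ.sum {n} (λ _ → c)        ≡⟨ Sumℤ.∑-distrib-+ {n} (position {n}) (λ _ → c) ⟨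
      Sumℤ.sum {n} (λ k → position k + c)
        ≡⟨ Sumℤ.sum-cong-≗ {n} (λ k → translation (suc (toℕ k))) ⟨
      windowSum n (to w)                             ≡⟨ normalised w ⟩
      + (suc n C 2)                                  ≡⟨ windowSum-id n ⟨
      windowSum n id                                 ≡⟨ ℤ.+-identityʳ _ ⟨
      windowSum n id + 0ℤ                            ∎)
    c≡0 : c ≡ 0ℤ
    c≡0 = ℤ.*-cancelˡ-≡ (+ n) c 0ℤ (trans nc≡0 (sym (ℤ.*-zeroʳ (+ n))))
    fixed : (k : Fin n) → to w (position k) ≡ position k
    fixed k = trans (translation (suc (toℕ k))) (trans (cong (λ x → position k + x) c≡0) (ℤ.+-identityʳ _))

  residue-position : (k : Fin n) → residue {n} (position k) ≡ k
  residue-position k = trans (cong (residue {n}) (sym (ℤ.+-identityʳ (position k)))) (residue-shift k 0ℤ)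

  residue-+* : ∀ i q → residue {n} (i + q * + n) ≡ residue {n} i
  residue-+* i q = begin
    residue {n} (i + q * + n)
      ≡⟨ cong (λ j → residue {n} (j + q * + n)) (decompose {n} i) ⟩
    residue {n} (position (residue {n} i) + p * + n + q * + n)
      ≡⟨ cong (residue {n}) (collect (position (residue {n} i)) p q (+ n)) ⟩
    residue {n} (position (residue {n} i) + (p + q) * + n)      ≡⟨ residue-shift _ (p + q) ⟩
    residue {n} i                                               ∎
    where
    open ≡-Reasoning
    p = quotient {n} i
    collect : ∀ r p q m → r + p * m + q * m ≡ r + (p + q) * m
    collect = solve-∀

  residue-≡ : ∀ i j → residue {n} i ≡ residue {n} j → ∃[ q ] i ≡ j + q * + n
  residue-≡ i j eq = quotient {n} i - quotient {n} j , (begin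
    i                                                             ≡⟨ decompose {n} i ⟩
    position (residue {n} i) + quotient {n} i * + n
      ≡⟨ cong (λ k → position k + quotient {n} i * + n) eq ⟩
    position (residue {n} j) + quotient {n} i * + n
      ≡⟨ split (position (residue {n} j)) (quotient {n} i) (quotient {n} j) (+ n) ⟩
    position (residue {n} j) + quotient {n} j * + n + (quotient {n} i - quotient {n} j) * + n
                                                                  ≡⟨ cong (_+ (quotient {n} i - quotient {n} j) * + n) (decompose {n} j) ⟨
    j + (quotient {n} i - quotient {n} j) * + n                   ∎)
    where
    open ≡-Reasoning
    split : ∀ r p q m → r + p * m ≡ r + q * m + (p - q) * m
    split = solve-∀

  -- The action of a simple generator on the integers.

  module Simple {a : Fin n} {s : AffinePermutation n} (simple : IsSimple a s) where
    open IsSimple simple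

    x : ℤ
    x = position a

    b : Fin n
    b = residue (x + 1ℤ)

    X : ℤ → ℤ
    X m = x + m * + n

    private
      X+1 : ∀ m → X m + 1ℤ ≡ (x + 1ℤ) + m * + n
      X+1 m = swap x (m * + n)
        where
        swap : ∀ x y → x + y + 1ℤ ≡ (x + 1ℤ) + y
        swap = solve-∀

    -- A case view by residue class. In the swapped classes the index is put in the form `X m` or
    -- `X m + 1ℤ`, to which `swap⁺` and `swap⁻` apply directly.
    data Action : ℤ → Set where
      up    : ∀ m → Action (X m)
      down  : ∀ m → Action (X m + 1ℤ)
      still : ∀ {j} → residue {n} j ≢ a → residue {n} j ≢ b → to s j ≡ j → Action j

    residue-up : ∀ m → residue {n} (X m) ≡ a
    residue-up m = residue-shift a m

    residue-down : ∀ m → residue {n} (X m + 1ℤ) ≡ b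
    residue-down m = trans (cong residue (X+1 m)) (residue-+* (x + 1ℤ) m)

    ≡a⇒up : ∀ j → residue {n} j ≡ a → ∃[ m ] j ≡ X m
    ≡a⇒up j eq = residue-≡ j x (trans eq (sym (residue-position a)))

    ≡b⇒down : ∀ j → residue {n} j ≡ b → ∃[ m ] j ≡ X m + 1ℤ
    ≡b⇒down j eq with residue-≡ j (x + 1ℤ) eq
    ... | m , j≡ = m , trans j≡ (sym (X+1 m))

    action : ∀ j → Action j
    action j with residue {n} j Fin.≟ a | residue {n} j Fin.≟ b
    ... | yes eq | _ with ≡a⇒up j eq
    ...   | m , refl = up m
    action j | no _ | yes eq with ≡b⇒down j eq
    ...   | m , refl = down m
    action j | no ≢a | no ≢b = still ≢a ≢b (fixed j
      (λ m j≡ → ≢a (trans (cong residue j≡) (residue-up m)))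
      (λ m j≡ → ≢b (trans (cong residue j≡) (residue-down m))))

    -- If the two classes agreed, `x` would be both `X 0ℤ` and some `X m + 1ℤ`, and the two swap
    -- rules would send it to integers differing by two. In particular `n` is at least 2.
    a≢b : a ≢ b
    a≢b a≡b with ≡b⇒down x (trans (residue-position a) a≡b)
    ... | m , x≡ = ℤ.<⇒≢ (ℤ.<-trans (i<i+1 (X m)) (i<i+1 (X m + 1ℤ))) (begin
      X m               ≡⟨ swap⁻ m ⟨
      to s (X m + 1ℤ)   ≡⟨ cong (to s) (trans (sym x≡) x≡X0) ⟩
      to s (X 0ℤ)       ≡⟨ swap⁺ 0ℤ ⟩
      X 0ℤ + 1ℤ         ≡⟨ cong (_+ 1ℤ) (trans (sym x≡X0) x≡) ⟩
      X m + 1ℤ + 1ℤ     ∎)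
      where
      open ≡-Reasoning
      x≡X0 : x ≡ X 0ℤ
      x≡X0 = sym (ℤ.+-identityʳ x)

    involutive : ∀ j → to s (to s j) ≡ j
    involutive j with action j
    ... | up m           = trans (cong (to s) (swap⁺ m)) (swap⁻ m)
    ... | down m         = trans (cong (to s) (swap⁻ m)) (swap⁺ m)
    ... | still _ _ sj≡j = trans (cong (to s) sj≡j) sj≡j

    from≡to : ∀ j → from s j ≡ to s j
    from≡to j = trans (cong (from s) (sym (involutive j))) (strictlyInverseʳ s (to s j))

    residue-s≡a : ∀ j → residue {n} (to s j) ≡ a → residue {n} j ≡ b
    residue-s≡a j eq with action j
    ... | up m          = contradiction (trans (sym eq) (trans (cong residue (swap⁺ m)) (residue-down m))) a≢b
    ... | down m        = residue-down m
    ... | still ≢a _ sj = contradiction (trans (cong residue (sym sj)) eq) ≢a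

    residue-s≡b : ∀ j → residue {n} (to s j) ≡ b → residue {n} j ≡ a
    residue-s≡b j eq with action j
    ... | up m          = residue-up m
    ... | down m        = contradiction (trans (sym (trans (cong residue (swap⁻ m)) (residue-up m))) eq) a≢b
    ... | still _ ≢b sj = contradiction (trans (cong residue (sym sj)) eq) ≢b

    -- No integer moves by more than one, so the order of two integers can be reversed only when
    -- they are adjacent and swapped with each other. The excluded case is exactly such a pair.
    s-mono : ∀ {i j} → i ≤ j → ¬ (residue {n} i ≡ a × j ≡ i + 1ℤ) → to s i ≤ to s j
    s-mono {i} {j} i≤j exclude with i ℤ.≟ j
    ... | yes refl = ℤ.≤-refl
    ... | no  i≢j  = <+1⇒≤ (ℤ.<-≤-trans si<j (j≤sj+1 j))
      where
      i<j = ℤ.≤∧≢⇒< i≤j i≢j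
      j≤sj+1 : ∀ j → j ≤ to s j + 1ℤ
      j≤sj+1 j with action j
      ... | up m         rewrite swap⁺ m = ℤ.≤-trans (ℤ.<⇒≤ (i<i+1 (X m))) (ℤ.<⇒≤ (i<i+1 (X m + 1ℤ)))
      ... | down m       rewrite swap⁻ m = ℤ.≤-refl
      ... | still _ _ sj rewrite sj      = ℤ.<⇒≤ (i<i+1 j)
      si<j : to s i < j
      si<j with action i
      ... | up m         rewrite swap⁺ m = ℤ.≤∧≢⇒< (<⇒+1≤ i<j) λ eq → exclude (residue-up m , sym eq)
      ... | down m       rewrite swap⁻ m = ℤ.<-trans (i<i+1 (X m)) i<j
      ... | still _ _ sj rewrite sj      = i<j

  -- Floors and inversion counts between residue classes.

  ⌊_/n⌋ : ℤ → ℤ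
  ⌊ t /n⌋ = t /ℕ n

  -- With `*≤⇒≤⌊⌋` this is the Galois connection between floors and multiples of `n`, from which the
  -- later facts on floors are derived.
  ≤⌊⌋⇒*≤ : ∀ m t → m ≤ ⌊ t /n⌋ → m * + n ≤ t
  ≤⌊⌋⇒*≤ m t m≤ = ℤ.≤-trans (ℤ.*-monoʳ-≤-nonNeg (+ n) m≤) ([n/ℕd]*d≤n t n)

  *≤⇒≤⌊⌋ : ∀ m t → m * + n ≤ t → m ≤ ⌊ t /n⌋
  *≤⇒≤⌊⌋ m t mn≤t = <+1⇒≤ (subst (m <_) (ℤ.+-comm 1ℤ ⌊ t /n⌋)
    (ℤ.*-cancelʳ-<-nonNeg (+ n) (ℤ.≤-<-trans mn≤t (n<s[n/ℕd]*d t n))))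

  ⌊⌋-unique : ∀ t q → q * + n ≤ t → ¬ (q + 1ℤ) * + n ≤ t → ⌊ t /n⌋ ≡ q
  ⌊⌋-unique t q lower upper = ℤ.≤-antisym
    (<+1⇒≤ (ℤ.≰⇒> λ q+1≤ → upper (≤⌊⌋⇒*≤ (q + 1ℤ) t q+1≤)))
    (*≤⇒≤⌊⌋ q t lower)

  ⌊⌋-cong : ∀ t t′ → (∀ m → m * + n ≤ t ⇔ m * + n ≤ t′) → ⌊ t /n⌋ ≡ ⌊ t′ /n⌋
  ⌊⌋-cong t t′ eqv = ℤ.≤-antisym
    (*≤⇒≤⌊⌋ _ t′ (Equivalence.to (eqv ⌊ t /n⌋) (≤⌊⌋⇒*≤ ⌊ t /n⌋ t ℤ.≤-refl)))
    (*≤⇒≤⌊⌋ _ t (Equivalence.from (eqv ⌊ t′ /n⌋) (≤⌊⌋⇒*≤ ⌊ t′ /n⌋ t′ ℤ.≤-refl)))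

  ⌊⌋-+* : ∀ t q → ⌊ t + q * + n /n⌋ ≡ ⌊ t /n⌋ + q
  ⌊⌋-+* t q = ⌊⌋-unique _ _
    (subst (_≤ t + q * + n) (sym (ℤ.*-distribʳ-+ (+ n) ⌊ t /n⌋ q))
      (ℤ.+-monoˡ-≤ (q * + n) (≤⌊⌋⇒*≤ _ t ℤ.≤-refl)))
    λ above → ℤ.<-irrefl refl (ℤ.<-≤-trans (i<i+1 ⌊ t /n⌋)
      (*≤⇒≤⌊⌋ (⌊ t /n⌋ + 1ℤ) t (subst₂ _≤_ (lhs ⌊ t /n⌋ q (+ n)) (rhs t (q * + n))
        (ℤ.+-monoˡ-≤ (- (q * + n)) above))))
    where
    lhs : ∀ f q m → (f + q + 1ℤ) * m + - (q * m) ≡ (f + 1ℤ) * m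
    lhs = solve-∀
    rhs : ∀ t d → t + d + - d ≡ t
    rhs = solve-∀

  -- For i ≢ j mod n, the number of inversions of g between the residue
  -- classes of i and j.
  crossings : (ℤ → ℤ) → ℤ → ℤ → ℕ
  crossings g i j = ∣ ⌊ i - j /n⌋ - ⌊ g i - g j /n⌋ ∣

  -- Every pair of residue classes is counted twice, so this is twice Shi's
  -- formula for the Coxeter length of g⁻¹.
  totalCrossings : (ℤ → ℤ) → ℕ
  totalCrossings g = ∑[ k < n ] ∑[ l < n ] crossings g (position k) (position l)

  totalCrossings-cong : ∀ {f g} → f ≗ g → totalCrossings f ≡ totalCrossings g
  totalCrossings-cong f≗g = Sumℕ.sum-cong-≗ {n} λ k → Sumℕ.sum-cong-≗ {n} λ l →
    cong₂ (λ y z → ∣ ⌊ position k - position l /n⌋ - ⌊ y - z /n⌋ ∣)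
      (f≗g (position k)) (f≗g (position l))

  totalCrossings-id : totalCrossings id ≡ 0
  totalCrossings-id = trans
    (Sumℕ.sum-cong-≗ {n} λ k → trans
      (Sumℕ.sum-cong-≗ {n} λ l → cong ∣_∣ (ℤ.+-inverseʳ (⌊ position k - position l /n⌋)))
      (Sumℕ.sum-replicate-zero n))
    (Sumℕ.sum-replicate-zero n)

  -- Shifting the arguments adds `p - q` to both floors, so the count depends only on residue
  -- classes.
  crossings-+* : ∀ g → Periodic n g → ∀ i j p q →
                 crossings g (i + p * + n) (j + q * + n) ≡ crossings g i j
  crossings-+* g per i j p q = cong ∣_∣ (begin
    ⌊ (i + p * + n) - (j + q * + n) /n⌋ - ⌊ g (i + p * + n) - g (j + q * + n) /n⌋
      ≡⟨ cong₂ _-_ (shift i j) (trans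
           (cong₂ (λ y z → ⌊ y - z /n⌋) (periodic-multiple n g per i p) (periodic-multiple n g per j q))
           (shift (g i) (g j))) ⟩
    (⌊ i - j /n⌋ + (p - q)) - (⌊ g i - g j /n⌋ + (p - q))
      ≡⟨ cancel (⌊ i - j /n⌋) (⌊ g i - g j /n⌋) (p - q) ⟩
    ⌊ i - j /n⌋ - ⌊ g i - g j /n⌋ ∎)
    where
    open ≡-Reasoning
    collect : ∀ i j p q m → (i + p * m) - (j + q * m) ≡ (i - j) + (p - q) * m
    collect = solve-∀
    cancel : ∀ y z d → (y + d) - (z + d) ≡ y - z
    cancel = solve-∀
    shift : ∀ i j → ⌊ (i + p * + n) - (j + q * + n) /n⌋ ≡ ⌊ i - j /n⌋ + (p - q)
    shift i j = trans (cong ⌊_/n⌋ (collect i j p q (+ n))) (⌊⌋-+* (i - j) (p - q))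

  crossings-residue : ∀ g → Periodic n g → ∀ i j →
    crossings g i j ≡ crossings g (position (residue {n} i)) (position (residue {n} j))
  crossings-residue g per i j = trans
    (cong₂ (crossings g) (decompose {n} i) (decompose {n} j))
    (crossings-+* g per (position (residue {n} i)) (position (residue {n} j)) (quotient {n} i) (quotient {n} j))

  -- An affine permutation permutes the residue classes, and each count depends only on the classes
  -- of its arguments, so the double sum can be reindexed.
  totalCrossings-permute : ∀ g → Periodic n g → (w : AffinePermutation n) →
    totalCrossings g ≡ ∑[ k < n ] ∑[ l < n ] crossings g (to w (position k)) (to w (position l))
  totalCrossings-permute g per w = begin
    ∑[ k < n ] ∑[ l < n ] crossings g (position k) (position l)
      ≡⟨ Sumℕ.∑-permute (λ k → ∑[ l < n ] crossings g (position k) (position l)) π ⟩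
    ∑[ k < n ] ∑[ l < n ] crossings g (position (π ⟨$⟩ʳ k)) (position l)
      ≡⟨ Sumℕ.sum-cong-≗ {n} (λ k → Sumℕ.∑-permute (λ l → crossings g (position (π ⟨$⟩ʳ k)) (position l)) π) ⟩
    ∑[ k < n ] ∑[ l < n ] crossings g (position (π ⟨$⟩ʳ k)) (position (π ⟨$⟩ʳ l))
      ≡⟨ Sumℕ.sum-cong-≗ {n} (λ k → Sumℕ.sum-cong-≗ {n} λ l →
           crossings-residue g per (to w (position k)) (to w (position l))) ⟨
    ∑[ k < n ] ∑[ l < n ] crossings g (to w (position k)) (to w (position l)) ∎
    where
    open ≡-Reasoning
    π = residuePermutation w

  ⌊-⌋-≥ : ∀ i j m → m * + n ≤ i - j ⇔ j + m * + n ≤ i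
  ⌊-⌋-≥ i j m = mk⇔
    (λ h → subst₂ _≤_ (ℤ.+-comm (m * + n) j) (cancel i j) (ℤ.+-monoˡ-≤ j h))
    (λ h → subst₂ _≤_ (cancel′ j (m * + n)) refl (ℤ.+-monoˡ-≤ (- j) h))
    where
    cancel : ∀ i j → i - j + j ≡ i
    cancel = solve-∀
    cancel′ : ∀ j d → j + d - j ≡ d
    cancel′ = solve-∀

  -- The effect of a simple generator on inversion counts.

  module _ {a : Fin n} {s : AffinePermutation n} (simple : IsSimple a s) where
    open Simple {a = a} {s} simple
    open IsSimple simple

    n≰1 : ¬ + n ≤ 1ℤ
    n≰1 (+≤+ n≤1) = a≢b (unique n≤1 a b)
      where
      unique : ∀ {n} → n ℕ.≤ 1 → (k l : Fin n) → k ≡ l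
      unique (ℕ.s≤s ℕ.z≤n) zero zero = refl

    s-shift-mono : ∀ i j m → ¬ (residue {n} i ≡ a × residue {n} j ≡ b) →
                   i + m * + n ≤ j → to s i + m * + n ≤ to s j
    s-shift-mono i j m exclude i≤j = subst (_≤ to s j) (periodic-multiple n (to s) (periodic s) i m)
      (s-mono i≤j λ { (≡a , refl) → exclude (i≡a ≡a , j≡b ≡a) })
      where
      i≡a : residue {n} (i + m * + n) ≡ a → residue {n} i ≡ a
      i≡a ≡a = trans (sym (residue-+* i m)) ≡a
      j≡b : residue {n} (i + m * + n) ≡ a → residue {n} (i + m * + n + 1ℤ) ≡ b
      j≡b ≡a with ≡a⇒up (i + m * + n) ≡a
      ... | p , eq = trans (cong (λ y → residue {n} (y + 1ℤ)) eq) (residue-down p)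

    -- The floor of `i - j` records which translates of `j` lie at or below `i`. A generator
    -- preserves these comparisons unless the residues are the two swapped classes, and being an
    -- involution it reflects them too.
    floor-stable : ∀ i j → ¬ (residue {n} i ≡ a × residue {n} j ≡ b) →
                   ¬ (residue {n} i ≡ b × residue {n} j ≡ a) →
                   ⌊ to s i - to s j /n⌋ ≡ ⌊ i - j /n⌋
    floor-stable i j ¬ab ¬ba = ⌊⌋-cong (to s i - to s j) (i - j) λ m → mk⇔
      (λ h → Equivalence.from (⌊-⌋-≥ i j m) (subst₂ (λ y z → y + m * + n ≤ z) (involutive j) (involutive i)
        (s-shift-mono (to s j) (to s i) m (λ (≡a , ≡b) → ¬ab (residue-s≡b i ≡b , residue-s≡a j ≡a))
          (Equivalence.to (⌊-⌋-≥ (to s i) (to s j) m) h))))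
      (λ h → Equivalence.from (⌊-⌋-≥ (to s i) (to s j) m)
        (s-shift-mono j i m (λ (≡a , ≡b) → ¬ba (≡b , ≡a)) (Equivalence.to (⌊-⌋-≥ i j m) h)))

    -- Distinctness of the two classes enters through `n ≥ 2`; for `n = 1` the floor would be 1.
    floor-1 : ⌊ 1ℤ /n⌋ ≡ 0ℤ
    floor-1 = ⌊⌋-unique 1ℤ 0ℤ (+≤+ ℕ.z≤n) λ h → n≰1 (subst (_≤ 1ℤ) (ℤ.*-identityˡ (+ n)) h)

    floor-−1 : ⌊ -1ℤ /n⌋ ≡ -1ℤ
    floor-−1 = ⌊⌋-unique -1ℤ -1ℤ
      (subst (_≤ -1ℤ) (sym (ℤ.-1*i≡-i (+ n))) (ℤ.neg-mono-≤ (ℤ.<⇒≤ (ℤ.≰⇒> n≰1)))) λ ()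

    floor-up-down : ∀ m m′ → ⌊ X m - (X m′ + 1ℤ) /n⌋ ≡ -1ℤ + (m - m′)
    floor-up-down m m′ = trans (cong ⌊_/n⌋ (rearrange x m m′ (+ n)))
      (trans (⌊⌋-+* -1ℤ (m - m′)) (cong (_+ (m - m′)) floor-−1))
      where
      rearrange : ∀ x m m′ k → (x + m * k) - (x + m′ * k + 1ℤ) ≡ -1ℤ + (m - m′) * k
      rearrange = solve-∀

    floor-down-up : ∀ m m′ → ⌊ X m + 1ℤ - X m′ /n⌋ ≡ 0ℤ + (m - m′)
    floor-down-up m m′ = trans (cong ⌊_/n⌋ (rearrange x m m′ (+ n)))
      (trans (⌊⌋-+* 1ℤ (m - m′)) (cong (_+ (m - m′)) floor-1))
      where
      rearrange : ∀ x m m′ k → (x + m * k + 1ℤ) - (x + m′ * k) ≡ 1ℤ + (m - m′) * k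
      rearrange = solve-∀

    module _ (g : ℤ → ℤ) (per : Periodic n g) (ascent : g x < g (x + 1ℤ)) where

      private
        g-X : ∀ m → g (X m) ≡ g x + m * + n
        g-X = periodic-multiple n g per x

        g-X+1 : ∀ m → g (X m + 1ℤ) ≡ g (x + 1ℤ) + m * + n
        g-X+1 m = trans (cong g (swap x (m * + n))) (periodic-multiple n g per (x + 1ℤ) m)
          where
          swap : ∀ x y → x + y + 1ℤ ≡ (x + 1ℤ) + y
          swap = solve-∀

        d = g (x + 1ℤ) - g x

        collect : ∀ y z m m′ k → (y + m * k) - (z + m′ * k) ≡ (y - z) + (m - m′) * k
        collect = solve-∀

        0≤floor : 0ℤ ≤ ⌊ d /n⌋
        0≤floor = *≤⇒≤⌊⌋ 0ℤ d (ℤ.i≤j⇒0≤j-i (ℤ.<⇒≤ ascent))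

        floor<0 : ⌊ g x - g (x + 1ℤ) /n⌋ < 0ℤ
        floor<0 = ℤ.≰⇒> λ 0≤ → ℤ.<-irrefl refl (ℤ.<-≤-trans ascent
          (ℤ.0≤i-j⇒j≤i (≤⌊⌋⇒*≤ 0ℤ (g x - g (x + 1ℤ)) 0≤)))

        floor-g-up-down : ∀ m m′ → ⌊ g (X m) - g (X m′ + 1ℤ) /n⌋ ≡ ⌊ g x - g (x + 1ℤ) /n⌋ + (m - m′)
        floor-g-up-down m m′ = trans
          (cong ⌊_/n⌋ (trans (cong₂ _-_ (g-X m) (g-X+1 m′)) (collect (g x) (g (x + 1ℤ)) m m′ (+ n))))
          (⌊⌋-+* (g x - g (x + 1ℤ)) (m - m′))

        floor-g-down-up : ∀ m m′ → ⌊ g (X m + 1ℤ) - g (X m′) /n⌋ ≡ ⌊ d /n⌋ + (m - m′)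
        floor-g-down-up m m′ = trans
          (cong ⌊_/n⌋ (trans (cong₂ _-_ (g-X+1 m) (g-X m′)) (collect (g (x + 1ℤ)) (g x) m m′ (+ n))))
          (⌊⌋-+* d (m - m′))

        cancel : ∀ y z d → (y + d) - (z + d) ≡ y - z
        cancel = solve-∀

        distance-neg : ∀ f → f < 0ℤ → ∣ 0ℤ - f ∣ ≡ ∣ -1ℤ - f ∣ ℕ.+ 1
        distance-neg (+ _)    (+<+ ())
        distance-neg -[1+ k ] _ = sym (trans (cong (λ y → ∣ y ∣ ℕ.+ 1) (lemma k)) (ℕ.+-comm k 1))
          where
          lemma : ∀ k → -1ℤ - -[1+ k ] ≡ + k
          lemma zero = refl
          lemma (suc k) = refl

        distance-nonneg : ∀ f → 0ℤ ≤ f → ∣ -1ℤ - f ∣ ≡ ∣ 0ℤ - f ∣ ℕ.+ 1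
        distance-nonneg (+ zero)  _ = refl
        distance-nonneg (+ suc k) _ = cong suc (ℕ.+-comm 1 k)

      -- The added term is 1 when `i` and `j` represent the two swapped classes, in either order,
      -- and 0 otherwise. On such a pair `s` exchanges the floors `-1ℤ` and `0ℤ` of the difference
      -- of positions, up to a common shift, and the sign of the floor for `g`, known from the
      -- ascent, shows that this moves one unit away from it.
      crossings-swap : ∀ i j →
        crossings (g ∘ to s) (to s i) (to s j) ≡
        crossings g i j ℕ.+
          (δ b (residue {n} j) ℕ.* δ a (residue {n} i) ℕ.+ δ a (residue {n} j) ℕ.* δ b (residue {n} i))
      crossings-swap i j = trans
        (cong₂ (λ y z → ∣ ⌊ to s i - to s j /n⌋ - ⌊ g y - g z /n⌋ ∣) (involutive i) (involutive j)) cases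
        where
        correction = δ b (residue {n} j) ℕ.* δ a (residue {n} i) ℕ.+ δ a (residue {n} j) ℕ.* δ b (residue {n} i)
        δ*δ : ∀ {a b k l : Fin n} → ¬ (k ≡ a × l ≡ b) → δ b l ℕ.* δ a k ≡ 0
        δ*δ {a} {b} {k} {l} ¬ab with b Fin.≟ l
        ... | no  b≢l  = cong (ℕ._* δ a k) (δ-≢ b≢l)
        ... | yes refl = trans (cong (δ b b ℕ.*_) (δ-≢ λ a≡k → ¬ab (sym a≡k , refl))) (ℕ.*-zeroʳ (δ b b))
        δ-values : ∀ {a b k l : Fin n} → a ≢ b → k ≡ a → l ≡ b → (δ b l ℕ.* δ a k ≡ 1) × (δ a l ℕ.* δ b k ≡ 0)
        δ-values {a} {b} a≢b refl refl = cong₂ ℕ._*_ (δ-refl b) (δ-refl a) , cong₂ ℕ._*_ (δ-≢ a≢b) refl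
        corr-up-down : residue {n} i ≡ a → residue {n} j ≡ b → correction ≡ 1
        corr-up-down i≡a j≡b with δ-values a≢b i≡a j≡b
        ... | one , none = cong₂ ℕ._+_ one none
        corr-down-up : residue {n} i ≡ b → residue {n} j ≡ a → correction ≡ 1
        corr-down-up i≡b j≡a with δ-values (a≢b ∘ sym) i≡b j≡a
        ... | one , none = cong₂ ℕ._+_ none one
        cases : ∣ ⌊ to s i - to s j /n⌋ - ⌊ g i - g j /n⌋ ∣ ≡ crossings g i j ℕ.+ correction
        cases with residue {n} i Fin.≟ a ×-dec residue {n} j Fin.≟ b
                 | residue {n} i Fin.≟ b ×-dec residue {n} j Fin.≟ a
        ... | no ¬ab | no ¬ba = trans (cong (λ y → ∣ y - ⌊ g i - g j /n⌋ ∣) (floor-stable i j ¬ab ¬ba))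
          (sym (trans (cong (λ y → crossings g i j ℕ.+ y) (cong₂ ℕ._+_ (δ*δ ¬ab) (δ*δ ¬ba)))
                      (ℕ.+-identityʳ (crossings g i j))))
        ... | yes (i≡a , j≡b) | _ with ≡a⇒up i i≡a | ≡b⇒down j j≡b
        ...   | m , refl | m′ , refl = begin
          ∣ ⌊ to s (X m) - to s (X m′ + 1ℤ) /n⌋ - ⌊ g (X m) - g (X m′ + 1ℤ) /n⌋ ∣
            ≡⟨ cong₂ (λ y z → ∣ y - z ∣) 
                 (trans (cong₂ (λ y z → ⌊ y - z /n⌋) (swap⁺ m) (swap⁻ m′)) (floor-down-up m m′))
                 (floor-g-up-down m m′) ⟩
          ∣ (0ℤ + (m - m′)) - (⌊ g x - g (x + 1ℤ) /n⌋ + (m - m′)) ∣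
            ≡⟨ cong ∣_∣ (cancel 0ℤ (⌊ g x - g (x + 1ℤ) /n⌋) (m - m′)) ⟩
          ∣ 0ℤ - ⌊ g x - g (x + 1ℤ) /n⌋ ∣
            ≡⟨ distance-neg (⌊ g x - g (x + 1ℤ) /n⌋) floor<0 ⟩
          ∣ -1ℤ - ⌊ g x - g (x + 1ℤ) /n⌋ ∣ ℕ.+ 1
            ≡⟨ cong₂ ℕ._+_ (cong ∣_∣ (sym (cancel -1ℤ (⌊ g x - g (x + 1ℤ) /n⌋) (m - m′))))
                         (sym (corr-up-down i≡a j≡b)) ⟩
          ∣ (-1ℤ + (m - m′)) - (⌊ g x - g (x + 1ℤ) /n⌋ + (m - m′)) ∣ ℕ.+ correction
            ≡⟨ cong (ℕ._+ correction) (cong₂ (λ y z → ∣ y - z ∣) (floor-up-down m m′) (floor-g-up-down m m′)) ⟨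
          crossings g (X m) (X m′ + 1ℤ) ℕ.+ correction ∎
          where
          open ≡-Reasoning
        cases | no _ | yes (i≡b , j≡a) with ≡b⇒down i i≡b | ≡a⇒up j j≡a
        ...   | m , refl | m′ , refl = begin
          ∣ ⌊ to s (X m + 1ℤ) - to s (X m′) /n⌋ - ⌊ g (X m + 1ℤ) - g (X m′) /n⌋ ∣
            ≡⟨ cong₂ (λ y z → ∣ y - z ∣) 
                 (trans (cong₂ (λ y z → ⌊ y - z /n⌋) (swap⁻ m) (swap⁺ m′)) (floor-up-down m m′))
                 (floor-g-down-up m m′) ⟩
          ∣ (-1ℤ + (m - m′)) - (⌊ d /n⌋ + (m - m′)) ∣
            ≡⟨ cong ∣_∣ (cancel -1ℤ (⌊ d /n⌋) (m - m′)) ⟩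
          ∣ -1ℤ - ⌊ d /n⌋ ∣
            ≡⟨ distance-nonneg (⌊ d /n⌋) 0≤floor ⟩
          ∣ 0ℤ - ⌊ d /n⌋ ∣ ℕ.+ 1
            ≡⟨ cong₂ ℕ._+_ (cong ∣_∣ (sym (cancel 0ℤ (⌊ d /n⌋) (m - m′)))) (sym (corr-down-up i≡b j≡a)) ⟩
          ∣ (0ℤ + (m - m′)) - (⌊ d /n⌋ + (m - m′)) ∣ ℕ.+ correction
            ≡⟨ cong (ℕ._+ correction) (cong₂ (λ y z → ∣ y - z ∣) (floor-down-up m m′) (floor-g-down-up m m′)) ⟨
          crossings g (X m + 1ℤ) (X m′) ℕ.+ correction ∎
          where
          open ≡-Reasoning

      -- After reindexing by `s` each pair is compared with itself, and only the ordered pairs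
      -- `(a , b)` and `(b , a)` gain, one each.
      totalCrossings-swap : totalCrossings (g ∘ to s) ≡ totalCrossings g ℕ.+ 2
      totalCrossings-swap = begin
        totalCrossings (g ∘ to s)
          ≡⟨ totalCrossings-permute (g ∘ to s) (λ i → trans (cong g (periodic s i)) (per (to s i))) s ⟩
        ∑[ k < n ] ∑[ l < n ] crossings (g ∘ to s) (to s (position k)) (to s (position l))
          ≡⟨ Sumℕ.sum-cong-≗ {n} (λ k → Sumℕ.sum-cong-≗ {n} λ l → trans
               (crossings-swap (position k) (position l))
               (cong₂ (λ k′ l′ → crossings g (position k) (position l) ℕ.+
                                   (δ b l′ ℕ.* δ a k′ ℕ.+ δ a l′ ℕ.* δ b k′))
                 (residue-position k) (residue-position l))) ⟩
        ∑[ k < n ] ∑[ l < n ] (crossings g (position k) (position l) ℕ.+ (δ b l ℕ.* δ a k ℕ.+ δ a l ℕ.* δ b k))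
          ≡⟨ Sumℕ.sum-cong-≗ {n} (λ k → trans
               (Sumℕ.∑-distrib-+ {n} (λ l → crossings g (position k) (position l))
                                    (λ l → δ b l ℕ.* δ a k ℕ.+ δ a l ℕ.* δ b k))
               (cong (λ y → ∑[ l < n ] crossings g (position k) (position l) ℕ.+ y) (trans
                 (Sumℕ.∑-distrib-+ {n} (λ l → δ b l ℕ.* δ a k) (λ l → δ a l ℕ.* δ b k))
                 (cong₂ ℕ._+_ (∑-δ b (δ a k)) (∑-δ a (δ b k)))))) ⟩
        ∑[ k < n ] (∑[ l < n ] crossings g (position k) (position l) ℕ.+ (δ a k ℕ.+ δ b k))
          ≡⟨ Sumℕ.∑-distrib-+ {n} (λ k → ∑[ l < n ] crossings g (position k) (position l)) (λ k → δ a k ℕ.+ δ b k) ⟩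
        totalCrossings g ℕ.+ ∑[ k < n ] (δ a k ℕ.+ δ b k)
          ≡⟨ cong (λ y → totalCrossings g ℕ.+ y) (trans
               (Sumℕ.∑-distrib-+ {n} (δ a) (δ b)) (cong₂ ℕ._+_ (∑-δ-1 a) (∑-δ-1 b))) ⟩
        totalCrossings g ℕ.+ 2 ∎
        where
        open ≡-Reasoning
        ∑-δ-1 : (c : Fin n) → ∑[ k < n ] δ c k ≡ 1
        ∑-δ-1 c = trans (Sumℕ.sum-cong-≗ {n} λ k → sym (ℕ.*-identityʳ (δ c k))) (∑-δ c 1)

  -- Construction of the simple generators.

  module Reflection (a : Fin n) (n≢1 : n ≢ 1) where

    h : ℤ → ℤ
    h j = if does (residue {n} j Fin.≟ a) then 1ℤ else 0ℤ

    h-≡ : ∀ j → residue {n} j ≡ a → h j ≡ 1ℤ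
    h-≡ j eq with residue {n} j Fin.≟ a
    ... | yes _ = refl
    ... | no  ≢ = contradiction eq ≢

    h-≢ : ∀ j → residue {n} j ≢ a → h j ≡ 0ℤ
    h-≢ j ≢a with residue {n} j Fin.≟ a
    ... | yes eq = contradiction eq ≢a
    ... | no  _  = refl

    h-+* : ∀ j q → h (j + q * + n) ≡ h j
    h-+* j q = cong (λ k → if does (k Fin.≟ a) then 1ℤ else 0ℤ) (residue-+* j q)

    -- With `h` the indicator of the class `a`, one formula moves that class up by one, the next
    -- class down by one, and fixes the rest. As the identity plus a difference of the periodic `h`,
    -- it has a window sum that telescopes to that of the identity.
    f : ℤ → ℤ
    f j = j + (h j - h (j - 1ℤ))

    residue-+1 : ∀ j → residue {n} (j + 1ℤ) ≢ residue {n} j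
    residue-+1 j eq with residue-≡ (j + 1ℤ) j eq
    ... | q , j+1≡ = n≢1 (∣1⇒≡1 (divides ∣ q ∣ (trans (cong ∣_∣ 1≡qn) (ℤ.abs-* q (+ n)))))
      where
      diff : ∀ j d → d ≡ j + d - j
      diff = solve-∀
      1≡qn : 1ℤ ≡ q * + n
      1≡qn = trans (diff j 1ℤ) (trans (cong (_- j) j+1≡) (sym (diff j (q * + n))))

    f-up : ∀ j → residue {n} j ≡ a → f j ≡ j + 1ℤ
    f-up j ≡a = cong₂ (λ y z → j + (y - z)) (h-≡ j ≡a) (h-≢ (j - 1ℤ) λ ≡a′ →
      residue-+1 (j - 1ℤ) (trans (trans (cong residue (cancel j)) ≡a) (sym ≡a′)))
      where
      cancel : ∀ j → j - 1ℤ + 1ℤ ≡ j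
      cancel = solve-∀

    f-down : ∀ j → residue {n} j ≡ a → f (j + 1ℤ) ≡ j
    f-down j ≡a = trans (cong₂ (λ y z → j + 1ℤ + (y - z)) 
      (h-≢ (j + 1ℤ) λ ≡a′ → residue-+1 j (trans ≡a′ (sym ≡a)))
      (trans (cong h (cancel j)) (h-≡ j ≡a))) (cancel j)
      where
      cancel : ∀ j → j + 1ℤ - 1ℤ ≡ j
      cancel = solve-∀

    f-fixed : ∀ j → residue {n} j ≢ a → residue {n} (j - 1ℤ) ≢ a → f j ≡ j
    f-fixed j ≢a ≢a′ = trans (cong₂ (λ y z → j + (y - z)) (h-≢ j ≢a) (h-≢ (j - 1ℤ) ≢a′)) (ℤ.+-identityʳ j)

    f-involutive : ∀ j → f (f j) ≡ j
    f-involutive j = cases (residue {n} j Fin.≟ a) (residue {n} (j - 1ℤ) Fin.≟ a)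
      where
      cancel : ∀ j → j ≡ j - 1ℤ + 1ℤ
      cancel = solve-∀
      cases : Dec (residue {n} j ≡ a) → Dec (residue {n} (j - 1ℤ) ≡ a) → f (f j) ≡ j
      cases (yes ≡a) _        = trans (cong f (f-up j ≡a)) (f-down j ≡a)
      cases (no ≢a) (no ≢a′)  = trans (cong f (f-fixed j ≢a ≢a′)) (f-fixed j ≢a ≢a′)
      cases (no _)  (yes ≡a)  = trans (cong f (trans (cong f (cancel j)) (f-down (j - 1ℤ) ≡a)))
                                        (trans (f-up (j - 1ℤ) ≡a) (sym (cancel j)))

    h-+n : ∀ j → h (j + + n) ≡ h j
    h-+n j = trans (cong (λ y → h (j + y)) (sym (ℤ.*-identityˡ (+ n)))) (h-+* j 1ℤ)

    f-periodic : Periodic n f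
    f-periodic j = trans
      (cong₂ (λ y z → j + + n + (y - z)) (h-+n j) (trans (cong h (swap j (+ n))) (h-+n (j - 1ℤ))))
      (rearrange j (+ n) (h j - h (j - 1ℤ)))
      where
      swap : ∀ j m → j + m - 1ℤ ≡ j - 1ℤ + m
      swap = solve-∀
      rearrange : ∀ j m d → j + m + d ≡ j + d + m
      rearrange = solve-∀

    f-normalised : windowSum n f ≡ windowSum n id
    f-normalised = begin
      windowSum n f
        ≡⟨ Sumℤ.∑-distrib-+ {n} position (λ k → h (position k) - h (position k - 1ℤ)) ⟩
      windowSum n id + Sumℤ.sum {n} (λ k → h (+ suc (toℕ k)) - h (+ toℕ k))
        ≡⟨ cong (λ y → windowSum n id + y) (telescope n (h ∘ +_)) ⟩
      windowSum n id + (h (+ n) - h 0ℤ)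
        ≡⟨ cong (λ y → windowSum n id + (y - h 0ℤ)) (h-+n 0ℤ) ⟩
      windowSum n id + (h 0ℤ - h 0ℤ)
        ≡⟨ cong (λ y → windowSum n id + y) (ℤ.+-inverseʳ (h 0ℤ)) ⟩
      windowSum n id + 0ℤ
        ≡⟨ ℤ.+-identityʳ (windowSum n id) ⟩
      windowSum n id ∎
      where open ≡-Reasoning

    reflection : AffinePermutation n
    reflection = record
      { bijection  = mk↔ₛ′ f f f-involutive f-involutive
      ; periodic   = f-periodic
      ; normalised = trans f-normalised (windowSum-id n)
      }

    isSimple : IsSimple a reflection
    isSimple = record
      { swap⁺ = λ m → f-up (position a + m * + n) (residue-shift a m)
      ; swap⁻ = λ m → f-down (position a + m * + n) (residue-shift a m)
      ; fixed = λ j not-up not-down → f-fixed j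
          (λ ≡a → case residue-≡ j (position a) (trans ≡a (sym (residue-position a))) of λ where
            (q , eq) → not-up q eq)
          (λ ≡a → case residue-≡ (j - 1ℤ) (position a) (trans ≡a (sym (residue-position a))) of λ where
            (q , eq) → not-down q (trans (cancel j) (cong (_+ 1ℤ) eq)))
      }
      where
      cancel : ∀ j → j ≡ j - 1ℤ + 1ℤ
      cancel = solve-∀

  -- For `n = 1` periodicity makes `g` rise by one at every step, so a descent guarantees at least
  -- two classes and the generator exists.
  descent⇒simple : (g : ℤ → ℤ) → Periodic n g → (a : Fin n) → g (position a + 1ℤ) < g (position a) →
                   ∃[ s ] IsSimple a s
  descent⇒simple g per a descent = reflection , isSimple
    where
    n≢1 : n ≢ 1
    n≢1 refl = ℤ.<-asym descent (subst (g (position a) <_) (sym (per (position a))) (i<i+1 _))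
    open Reflection a n≢1

  -- Coxeter length by counting inversions.

  doubleLength : AffinePermutation n → ℕ
  doubleLength w = totalCrossings (from w)

  from-cong : (v w : AffinePermutation n) → v ≈ w → ∀ j → from v j ≡ from w j
  from-cong v w = Group.⁻¹-cong (affineSymmetricGroup n) {v} {w}

  doubleLength-cong : (v w : AffinePermutation n) → v ≈ w → doubleLength v ≡ doubleLength w
  doubleLength-cong v w v≈w = totalCrossings-cong (from-cong v w v≈w)

  -- Left multiplication by `s` precomposes the inverse with `s`, which is why lengths are measured
  -- on `from w` and descents are read off there.
  ascent⇒doubleLength : ∀ {a s} → IsSimple a s → (w : AffinePermutation n) →
    from w (position a) < from w (position a + 1ℤ) → doubleLength (s ∙ w) ≡ doubleLength w ℕ.+ 2
  ascent⇒doubleLength {a} {s} simple w ascent = trans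
    (totalCrossings-cong (λ j → cong (from w) (Simple.from≡to {a = a} {s} simple j)))
    (totalCrossings-swap {a} {s} simple (from w) (periodic-inverse w) ascent)

  cancel-simple : ∀ {a s} → IsSimple a s → (w : AffinePermutation n) → s ∙ (s ∙ w) ≈ w
  cancel-simple {a} {s} simple w j = Simple.involutive {a = a} {s} simple (to w j)

  -- The generator turns a descent of `w` into an ascent of `s ∙ w`, and multiplying by `s` again
  -- recovers `w`.
  descent⇒doubleLength : ∀ {a s} → IsSimple a s → (w : AffinePermutation n) →
    from w (position a + 1ℤ) < from w (position a) → doubleLength w ≡ doubleLength (s ∙ w) ℕ.+ 2
  descent⇒doubleLength {a} {s} simple w descent = trans
    (doubleLength-cong w (s ∙ (s ∙ w)) (λ j → sym (cancel-simple simple w j)))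
    (ascent⇒doubleLength simple (s ∙ w) (subst₂ _<_
      (cong (from w) (sym (trans (Simple.from≡to {a = a} {s} simple _) up)))
      (cong (from w) (sym (trans (Simple.from≡to {a = a} {s} simple _) down))) descent))
    where
    x = position a
    up : to s x ≡ x + 1ℤ
    up = trans (cong (to s) (sym (ℤ.+-identityʳ x)))
           (trans (IsSimple.swap⁺ simple 0ℤ) (cong (_+ 1ℤ) (ℤ.+-identityʳ x)))
    down : to s (x + 1ℤ) ≡ x
    down = trans (cong (to s) (sym up)) (Simple.involutive {a = a} {s} simple x)

  -- Each letter changes `doubleLength` by 2, up or down, so `l` letters reach at most twice `l`.
  -- This bounds the length from below.
  doubleLength-≤ : ∀ l w → IsProductOfSimples l w → doubleLength w ℕ.≤ l ℕ.+ l
  doubleLength-≤ zero w w≈ε = ℕ.≤-reflexive (trans (doubleLength-cong w ε w≈ε) (totalCrossings-id))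
  doubleLength-≤ (suc l) w (a , s , w′ , simple , w≈ , product) = begin
    doubleLength w         ≡⟨ doubleLength-cong w (s ∙ w′) w≈ ⟩
    doubleLength (s ∙ w′)  ≤⟨ bound ⟩
    l ℕ.+ l ℕ.+ 2          ≡⟨ ℕ.+-comm (l ℕ.+ l) 2 ⟩
    2 ℕ.+ (l ℕ.+ l)        ≡⟨ cong suc (ℕ.+-suc l l) ⟨
    suc l ℕ.+ suc l        ∎
    where
    open ℕ.≤-Reasoning
    ih = doubleLength-≤ l w′ product
    bound : doubleLength (s ∙ w′) ℕ.≤ l ℕ.+ l ℕ.+ 2
    bound with ℤ.<-cmp (from w′ (position a)) (from w′ (position a + 1ℤ))
    ... | tri< ascent _ _ = subst (ℕ._≤ l ℕ.+ l ℕ.+ 2)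
      (sym (ascent⇒doubleLength simple w′ ascent)) (ℕ.+-monoˡ-≤ 2 ih)
    ... | tri≈ _ eq _     = contradiction (i<i+1 (position a)) (ℤ.<-irrefl (to-injective (w′ ⁻¹) eq))
    ... | tri> _ _ descent = ℕ.≤-trans (ℕ.m≤m+n _ 2) (ℕ.≤-trans
      (ℕ.≤-reflexive (sym (descent⇒doubleLength simple w′ descent))) (ℕ.≤-trans ih (ℕ.m≤m+n _ 2)))

  -- Periodicity extends the absence of descents from one window to all integers, so the inverse is
  -- monotone and hence trivial.
  ¬descent⇒≈ε : (w : AffinePermutation n) →
    ¬ (∃[ a ] from w (position {n} a + 1ℤ) < from w (position a)) → w ≈ ε
  ¬descent⇒≈ε w ¬descent j = trans
    (cong (to w) (sym (monotone⇒≈ε (w ⁻¹) (λ {i} {k} → monotone (from w) step {i} {k}) j)))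
    (strictlyInverseˡ w j)
    where
    step : ∀ j → from w j ≤ from w (j + 1ℤ)
    step j = subst₂ _≤_
      (trans (sym (periodic-multiple n (from w) (periodic-inverse w) x q))
        (cong (from w) (sym (decompose {n} j))))
      (trans (sym (periodic-multiple n (from w) (periodic-inverse w) (x + 1ℤ) q))
        (cong (from w) (trans (swap x (q * + n)) (cong (_+ 1ℤ) (sym (decompose {n} j))))))
      (ℤ.+-monoˡ-≤ (q * + n) (ℤ.≮⇒≥ λ descent → ¬descent (residue {n} j , descent)))
      where
      x = position (residue {n} j)
      q = quotient {n} j
      swap : ∀ x d → x + 1ℤ + d ≡ x + d + 1ℤ
      swap = solve-∀

  +-cancel-≤ : ∀ {l m} → l ℕ.+ l ℕ.≤ m ℕ.+ m → l ℕ.≤ m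
  +-cancel-≤ 2l≤2m = ℕ.≮⇒≥ λ m<l → ℕ.<-irrefl refl (ℕ.<-≤-trans (ℕ.+-mono-< m<l m<l) 2l≤2m)

  double-suc : ∀ l → suc l ℕ.+ suc l ≡ l ℕ.+ l ℕ.+ 2
  double-suc l = trans (cong suc (ℕ.+-suc l l)) (ℕ.+-comm 2 (l ℕ.+ l))

  halve-+2 : ∀ l m → m ℕ.+ m ≡ l ℕ.+ l ℕ.+ 2 → m ≡ suc l
  halve-+2 l m eq = ℕ.≤-antisym
    (+-cancel-≤ (ℕ.≤-reflexive (trans eq (sym (double-suc l)))))
    (+-cancel-≤ (ℕ.≤-reflexive (trans (double-suc l) (sym eq))))

  ReducedWord : AffinePermutation n → Set
  ReducedWord w = ∃[ l ] l ℕ.+ l ≡ doubleLength w × IsProductOfSimples l w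

  prependSimple : ∀ {a s} → IsSimple a s → (w : AffinePermutation n) →
    from w (position a + 1ℤ) < from w (position a) → ReducedWord (s ∙ w) → ReducedWord w
  prependSimple {a} {s} simple w descent (l , 2l≡ , product) =
    suc l ,
    trans (double-suc l) (trans (cong (ℕ._+ 2) 2l≡) (sym (descent⇒doubleLength simple w descent))) ,
    a , s , s ∙ w , simple , (λ j → sym (cancel-simple simple w j)) , product

  -- Removing descents one at a time builds the word. The fuel bounds `doubleLength`, which each
  -- removal lowers by two, so it cannot run out before a permutation without descents is reached.
  reducedWord : ∀ fuel w → doubleLength w ℕ.≤ fuel → ReducedWord w
  reducedWord fuel w bound = cases (Fin.any? λ a → from w (position {n} a + 1ℤ) ℤ.<? from w (position a))
    where
    shorten : ∀ {a s} → IsSimple a s → from w (position a + 1ℤ) < from w (position a) →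
              ∀ fuel → doubleLength w ℕ.≤ fuel → ReducedWord (s ∙ w)
    cases : Dec (∃[ a ] from w (position {n} a + 1ℤ) < from w (position a)) → ReducedWord w
    cases (no ¬descent) = 0 , sym (trans (doubleLength-cong w ε w≈ε) totalCrossings-id) , w≈ε
      where w≈ε = ¬descent⇒≈ε w ¬descent
    cases (yes (a , descent)) =
      let s , simple = descent⇒simple (from w) (periodic-inverse w) a descent
      in prependSimple simple w descent (shorten simple descent fuel bound)
    shorten {a} {s} simple descent fuel bound = go fuel
      (subst (ℕ._≤ fuel) (trans (descent⇒doubleLength simple w descent) (ℕ.+-comm (doubleLength (s ∙ w)) 2))
        bound)
      where
      go : ∀ fuel → 2 ℕ.+ doubleLength (s ∙ w) ℕ.≤ fuel → ReducedWord (s ∙ w)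
      go (suc fuel) (ℕ.s≤s bound) = reducedWord fuel (s ∙ w) (ℕ.≤-trans (ℕ.n≤1+n _) bound)

  hasLength : ∀ w → ∃[ l ] l ℕ.+ l ≡ doubleLength w × HasLength w l
  hasLength w with reducedWord (doubleLength w) w ℕ.≤-refl
  ... | l , 2l≡ , product = l , 2l≡ , product , λ m product′ →
    +-cancel-≤ (ℕ.≤-trans (ℕ.≤-reflexive 2l≡) (doubleLength-≤ m w product′))

  -- The quotient of `p` by `s ∙ p` is `s` itself, of length one, and `doubleLength` gives the same
  -- difference between the two lengths.
  descent⇒≤L : ∀ {a s} → IsSimple a s → (p : AffinePermutation n) →
    from p (position a + 1ℤ) < from p (position a) → s ∙ p ≤L p
  descent⇒≤L {a} {s} simple p descent
    with hasLength (s ∙ p) | hasLength p | hasLength (p ∙ (s ∙ p) ⁻¹)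
  ... | k , 2k≡ , lengthSp | m , 2m≡ , lengthP | c , 2c≡ , lengthC =
    k , m , c , lengthSp , lengthP , lengthC , (begin
      + c                   ≡⟨ cong +_ c≡1 ⟩
      1ℤ                    ≡⟨ difference (+ k) ⟩
      1ℤ + + k - + k        ≡⟨ cong (λ y → + y - + k) m≡1+k ⟨
      + m - + k             ∎)
    where
    open ≡-Reasoning
    difference : ∀ k → 1ℤ ≡ 1ℤ + k - k
    difference = solve-∀
    m≡1+k : m ≡ suc k
    m≡1+k = halve-+2 k m (trans 2m≡ (trans (descent⇒doubleLength simple p descent) (cong (ℕ._+ 2) (sym 2k≡))))
    -- The form `s ∙ ε` lets its length be computed from the ascent of the identity.
    quotient≈s : p ∙ (s ∙ p) ⁻¹ ≈ s ∙ ε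
    quotient≈s j = trans (strictlyInverseˡ p (from s j)) (Simple.from≡to {a = a} {s} simple j)
    c≡1 : c ≡ 1
    c≡1 = halve-+2 0 c (begin
      c ℕ.+ c                           ≡⟨ 2c≡ ⟩
      doubleLength (p ∙ (s ∙ p) ⁻¹)     ≡⟨ doubleLength-cong (p ∙ (s ∙ p) ⁻¹) (s ∙ ε) quotient≈s ⟩
      doubleLength (s ∙ ε)              ≡⟨ ascent⇒doubleLength simple ε (i<i+1 (position a)) ⟩
      totalCrossings id ℕ.+ 2           ≡⟨ cong (ℕ._+ 2) totalCrossings-id ⟩
      2                                 ∎)

  -- Minimal representatives and postorder.

  incomparable-+* : (w : AffinePermutation n) → ∀ i j q →
    Incomparable w i j → Incomparable w (i + q * + n) (j + q * + n)
  incomparable-+* w i j q (k , c , d , e) = k + q * + n ,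
    subst (_< k + q * + n) (ℤ.mono-<-distrib-⊓ (_+ q * + n) (ℤ.+-monoˡ-< (q * + n)) i j)
      (ℤ.+-monoˡ-< (q * + n) c) ,
    subst (k + q * + n <_) (ℤ.mono-<-distrib-⊔ (_+ q * + n) (ℤ.+-monoˡ-< (q * + n)) i j)
      (ℤ.+-monoˡ-< (q * + n) d) ,
    subst₂ _<_
      (trans (ℤ.mono-<-distrib-⊔ (_+ q * + n) (ℤ.+-monoˡ-< (q * + n)) (to w i) (to w j))
        (cong₂ _⊔_ (sym (periodic-multiple n (to w) (periodic w) i q))
                   (sym (periodic-multiple n (to w) (periodic w) j q))))
      (sym (periodic-multiple n (to w) (periodic w) k q))
      (ℤ.+-monoˡ-< (q * + n) e)

  -- Only labels `X m` and `X m + 1ℤ` can be reversed. By periodicity the nodes carrying them are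
  -- incomparable for every `m`, so `s ∙ p` is still a decreasing labelling of the tree of `p`.
  descent-congruent : ∀ {a s} → IsSimple a s → (p : AffinePermutation n) →
    Incomparable p (from p (position a + 1ℤ)) (from p (position a)) →
    from p (position a + 1ℤ) < from p (position a) → s ∙ p ≡syl p
  descent-congruent {a} {s} simple p incomparable descent =
    labelling⇒≡syl (s ∙ p) p λ i j (i∼j , pi≤pj) →
    s-mono pi≤pj λ (≡a , pj≡) → i∼j (separate i j (≡a⇒up (to p i) ≡a) pj≡)
    where
    open Simple {a = a} {s} simple
    separate : ∀ i j → ∃[ m ] to p i ≡ X m → to p j ≡ to p i + 1ℤ → Incomparable p i j
    separate i j (m , pi≡) pj≡ = incomparable-sym p (subst₂ (Incomparable p) j≡ i≡
      (incomparable-+* p (from p (x + 1ℤ)) (from p x) m incomparable))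
      where
      i≡ : from p x + m * + n ≡ i
      i≡ = trans (sym (periodic-multiple n (from p) (periodic-inverse p) x m))
             (trans (cong (from p) (sym pi≡)) (strictlyInverseʳ p i))
      j≡ : from p (x + 1ℤ) + m * + n ≡ j
      j≡ = trans (sym (periodic-multiple n (from p) (periodic-inverse p) (x + 1ℤ) m))
             (trans (cong (from p) (trans (swap x (m * + n)) (trans (cong (_+ 1ℤ) (sym pi≡)) (sym pj≡))))
               (strictlyInverseʳ p j))
        where
        swap : ∀ x d → x + 1ℤ + d ≡ x + d + 1ℤ
        swap = solve-∀

  -- An inverted pair of consecutive labels at incomparable nodes can be moved by periodicity into
  -- the window, where a generator swaps it. The result is congruent to `p` and below it, so
  -- minimality makes the two equal, although `doubleLength` drops by two.
  minimal⇒postorder : {p w : AffinePermutation n} → IsMinimalRepresentative p w → IncomparableIncreasing p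
  minimal⇒postorder {p} {w} record { congruent = congruent ; minimal = minimal } =
    ¬inversion⇒postorder p λ x inversion incomparable → no-descent (residue {n} x)
      (subst₂ _<_ (shift+1 x) (shift x) (ℤ.+-monoˡ-< ((- quotient {n} x) * + n) inversion))
      (subst₂ (Incomparable p) (shift+1 x) (shift x)
        (incomparable-+* p (from p (x + 1ℤ)) (from p x) (- quotient {n} x) incomparable))
    where
    no-descent : ∀ a → from p (position {n} a + 1ℤ) < from p (position a) →
                 ¬ Incomparable p (from p (position a + 1ℤ)) (from p (position a))
    no-descent a descent incomparable =
      let s , simple = descent⇒simple (from p) (periodic-inverse p) a descent in
      ℕ.m≢1+n+m (doubleLength p) {1} (begin
        doubleLength p                ≡⟨ descent⇒doubleLength simple p descent ⟩
        doubleLength (s ∙ p) ℕ.+ 2    ≡⟨ cong (ℕ._+ 2) (doubleLength-cong (s ∙ p) p (sp≈p simple)) ⟩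
        doubleLength p ℕ.+ 2          ≡⟨ ℕ.+-comm (doubleLength p) 2 ⟩
        2 ℕ.+ doubleLength p          ∎)
      where
      open ≡-Reasoning
      sp≈p : ∀ {s} → IsSimple a s → s ∙ p ≈ p
      sp≈p {s} simple = minimal (s ∙ p)
        (≡syl-trans (s ∙ p) p w (descent-congruent simple p incomparable descent) congruent)
        (descent⇒≤L simple p descent)
    shift-from : ∀ x q {y} → x + q * + n ≡ y → from p x + q * + n ≡ from p y
    shift-from x q eq = trans (sym (periodic-multiple n (from p) (periodic-inverse p) x q)) (cong (from p) eq)
    shift : ∀ x → from p x + (- quotient {n} x) * + n ≡ from p (position (residue {n} x))
    shift x = shift-from x (- quotient {n} x) (trans
      (cong (_+ (- quotient {n} x) * + n) (decompose {n} x))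
      (cancel (position (residue {n} x)) (quotient {n} x) (+ n)))
      where
      cancel : ∀ r q m → r + q * m + (- q) * m ≡ r
      cancel = solve-∀
    shift+1 : ∀ x → from p (x + 1ℤ) + (- quotient {n} x) * + n ≡ from p (position (residue {n} x) + 1ℤ)
    shift+1 x = shift-from (x + 1ℤ) (- quotient {n} x) (trans
      (cong (λ y → y + 1ℤ + (- quotient {n} x) * + n) (decompose {n} x))
      (cancel (position (residue {n} x)) (quotient {n} x) (+ n)))
      where
      cancel : ∀ r q m → r + q * m + 1ℤ + (- q) * m ≡ r + 1ℤ
      cancel = solve-∀

  -- Left translation of stack-sorting subtrees.

  ≈ε-≡syl : (v w : AffinePermutation n) → v ≡syl w → w ≈ ε → v ≈ ε
  -- All positions `i ≤ j` are related for the identity, so every element of its class is monotone.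
  -- This carries the condition `¬ (w ≈ ε)` in `IsParent` across a translation.
  ≈ε-≡syl v w v≡w w≈ε = monotone⇒≈ε v λ {i} {j} i≤j →
    proj₂ (Equivalence.from (v≡ε i j) (ε-comparable i≤j , i≤j))
    where
    v≡ε = ≡syl-trans v w ε v≡w (≈⇒≡syl w ε w≈ε)
    ε-comparable : ∀ {i j} → i ≤ j → ¬ Incomparable {n} ε i j
    ε-comparable i≤j (k , _ , k<i⊔j , i⊔j<k) = ℤ.<-asym k<i⊔j i⊔j<k

  -- Both `u` and `z ∙ u` factor through the same `p`, as `u′ ∙ p` and `(z ∙ u′) ∙ p`; postorder of
  -- `p` lets the congruence of the left factors pass to the products.
  translate-congruent : {z u u′ : AffinePermutation n} → StackSorts u u′ → z ∙ u′ ≡syl u′ → z ∙ u ≡syl u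
  translate-congruent {z} {u} {u′} (p , min , u′≈) zu′≡u′ =
    ≡syl-trans (z ∙ u) ((z ∙ u′) ∙ p) u (≈⇒≡syl (z ∙ u) ((z ∙ u′) ∙ p) (λ j → cong (to z) (sym (u′p≈u j))))
      (≡syl-trans ((z ∙ u′) ∙ p) p u
        (IncomparableIncreasing-∙ u′ (z ∙ u′) p (minimal⇒postorder min) (≡syl-sym (z ∙ u′) u′ zu′≡u′)
          (≡syl-trans (u′ ∙ p) u p (≈⇒≡syl (u′ ∙ p) u u′p≈u) (≡syl-sym p u congruent)))
        congruent)
    where
    open IsMinimalRepresentative min
    u′p≈u : u′ ∙ p ≈ u
    u′p≈u j = trans (u′≈ (to p j)) (cong (to u) (strictlyInverseʳ p j))

  -- Congruent elements share their minimal representative, so only the quotients by it are left to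
  -- compare. The comparison is asked for every `p` because the representative is hidden in the
  -- `StackSorts` hypothesis.
  StackSorts-≡syl : {u u′ x x′ : AffinePermutation n} → x ≡syl u →
    (∀ p → u′ ≈ u ∙ p ⁻¹ → x′ ≈ x ∙ p ⁻¹) → StackSorts u u′ → StackSorts x x′
  StackSorts-≡syl {u} {u′} {x} {x′} x≡u quotient (p , min , u′≈) = p , record
    { congruent = ≡syl-trans p u x congruent (≡syl-sym x u x≡u)
    ; minimal   = λ y y≡x → minimal y (≡syl-trans y x u y≡x x≡u)
    } , quotient p u′≈
    where open IsMinimalRepresentative min

  ∙⁻¹-cancel : (v w : AffinePermutation n) → (w ∙ v ⁻¹) ∙ (v ∙ w ⁻¹) ≈ ε
  ∙⁻¹-cancel v w i = trans (cong (to w) (strictlyInverseʳ v (from w i))) (strictlyInverseˡ w i)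

  module Translation (v w : AffinePermutation n) (v≡w : v ≡syl w) where

    z : AffinePermutation n
    z = w ∙ v ⁻¹

    zv≈w : z ∙ v ≈ w
    zv≈w j = cong (to w) (strictlyInverseʳ v j)

    zv≡v : z ∙ v ≡syl v
    zv≡v = ≡syl-trans (z ∙ v) w v (≈⇒≡syl (z ∙ v) w zv≈w) (≡syl-sym v w v≡w)

    forward : ∀ {u u′} → z ∙ u ≡syl u → StackSorts u u′ → StackSorts (z ∙ u) (z ∙ u′)
    forward {u} {u′} zu≡u = StackSorts-≡syl {u} {u′} {z ∙ u} {z ∙ u′} zu≡u λ p u′≈ j → cong (to z) (u′≈ j)

    backward : ∀ {u u′} → z ∙ u ≡syl u → StackSorts (z ∙ u) (z ∙ u′) → StackSorts u u′
    backward {u} {u′} zu≡u = StackSorts-≡syl {z ∙ u} {z ∙ u′} {u} {u′} (≡syl-sym (z ∙ u) u zu≡u)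
      λ p zu′≈ j → to-injective z (zu′≈ j)

    -- The congruence of `z ∙ u` with `u` travels up the tree with the iterate: known for the
    -- parent, it follows for the child, and then `z` preserves the edge between them.
    descendant : ∀ t u → StackSorts^ t u v → z ∙ u ≡syl u × StackSorts^ t (z ∙ u) w
    descendant zero u u≈v =
      ≡syl-trans (z ∙ u) (z ∙ v) u (≈⇒≡syl (z ∙ u) (z ∙ v) λ j → cong (to z) (u≈v j))
        (≡syl-trans (z ∙ v) v u zv≡v (≈⇒≡syl v u λ j → sym (u≈v j))) ,
      λ j → trans (cong (to z) (u≈v j)) (zv≈w j)
    descendant (suc t) u (u′ , sorts , iterate) with descendant t u′ iterate
    ... | zu′≡u′ , iterate′ = zu≡u , z ∙ u′ , forward {u} {u′} zu≡u sorts , iterate′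
      where zu≡u = translate-congruent {z = z} {u} {u′} sorts zu′≡u′

    -- `forward` would end in `z ∙ v`; here the target is `w` itself, reached through `zv≈w`.
    preimage : ∀ u → StackSorts u v → StackSorts (z ∙ u) w
    preimage u sorts = StackSorts-≡syl {u} {v} {z ∙ u} {w} (translate-congruent {z = z} {u} {v} sorts zv≡v)
      (λ p v≈ j → trans (sym (zv≈w j)) (cong (to z) (v≈ j))) sorts

  subtree-≅ : (v w : AffinePermutation n) → v ≡syl w → subtree v ≅ subtree w
  subtree-≅ v w v≡w = record
    { vertexBijection = record
      { to        = λ (u , t , iterate) → z ∙ u , t , proj₂ (descendant t u iterate)
      -- The inverse is translation by `v ∙ w ⁻¹`, the same construction with the roles of `v` and
      -- `w` exchanged.
      ; from      = λ (u , t , iterate) → Back.z ∙ u , t , proj₂ (Back.descendant t u iterate)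
      ; to-cong   = λ u≈ j → cong (to z) (u≈ j)
      ; from-cong = λ u≈ j → cong (to Back.z) (u≈ j)
      ; inverse   = (λ {x} y≈ j → trans (cong (to z) (y≈ j)) (∙⁻¹-cancel v w (to (proj₁ x) j)))
                  , (λ {x} y≈ j → trans (cong (to Back.z) (y≈ j)) (∙⁻¹-cancel w v (to (proj₁ x) j)))
      }
    ; preservesRoot   = zv≈w
    ; preservesParent = λ (u , t , iterate) (u′ , _) →
        let zu≡u = proj₁ (descendant t u iterate)
            u≡zu = ≡syl-sym (z ∙ u) u zu≡u
        in mk⇔
          (λ (u≉ε , sorts) → u≉ε ∘ ≈ε-≡syl u (z ∙ u) u≡zu , forward {u} {u′} zu≡u sorts)
          (λ (zu≉ε , sorts) → zu≉ε ∘ ≈ε-≡syl (z ∙ u) u zu≡u , backward {u} {u′} zu≡u sorts)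
    }
    where
    open Translation v w v≡w
    module Back = Translation w v (≡syl-sym v w v≡w)

  sameFertility : (v w : AffinePermutation n) → v ≡syl w → SameFertility v w
  sameFertility v w v≡w = record
    { to        = λ (u , sorts) → z ∙ u , preimage u sorts
    ; from      = λ (u , sorts) → Back.z ∙ u , Back.preimage u sorts
    ; to-cong   = λ u≈ j → cong (to z) (u≈ j)
    ; from-cong = λ u≈ j → cong (to Back.z) (u≈ j)
    ; inverse   = (λ {x} y≈ j → trans (cong (to z) (y≈ j)) (∙⁻¹-cancel v w (to (proj₁ x) j)))
                , (λ {x} y≈ j → trans (cong (to Back.z) (y≈ j)) (∙⁻¹-cancel w v (to (proj₁ x) j)))
    }
    where
    open Translation v w v≡w
    module Back = Translation w v (≡syl-sym v w v≡w)

theorem8p4 : ∀ {n} .{{_ : NonZero n}} (v w : AffinePermutation n) → v ≡syl w →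
    (subtree v ≅ subtree w) × SameFertility v w
theorem8p4 v w v≡w = subtree-≅ v w v≡w , sameFertility v w v≡w
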